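{- For integers $n\ge2$ and $0\le t\le n-1$, the number of $(102,210)$-avoiding inversion sequences $e$ of length $n$ with $\mathrm{rank}(e)=t$ is $$c(n-t-1,t+1)+(t+1)\sum_{i=0}^{n-t-3}\binom{2i+t+3}{i}+\sum_{i=0}^{n-t-4}\big(c(i,t+6)-c(i,5)\big),$$ where $c(j,k):=\frac{k}{2j+k}\binom{2j+k}{j}=[x^j]C(x)^k$ and $C(x)=\sum_{n\ge0}\frac{1}{n+1}\binom{2n}{n}x^n$ is the generating function of the Catalan numbers. (Sums whose upper limit is less than their lower limit are $0$.)
   Context: An inversion sequence of length $n$ is an integer sequence $e=(e_1,\dots,e_n)$ with $0\le e_j\le j-1$ for all $j$. It contains a pattern $w=w_1w_2w_3$ if there are indices $i_1<i_2<i_3$ such that $e_{i_1}e_{i_2}e_{i_3}$ is order-isomorphic to $w$ (same relations $<,=,>$ between corresponding pairs of entries); otherwise it avoids $w$. "$(w,w')$-avoiding" means avoiding both $w$ and $w'$. $\max(e)$ is the largest entry, and $\mathrm{fdes}(e)$ is the position $p$ of the first descent: $e_1\le\cdots\le e_p>e_{p+1}$, with the convention $e_{n+1}=-1$. For a $102$-avoiding $e$, $\mathrm{rank}(e):=\mathrm{fdes}(e)-\max(e)-1$. -}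

module Defs where

open import Data.Bool using (if_then_else_)
open import Data.Fin as Fin using (Fin; toℕ)
open import Data.Integer as ℤ using (ℤ; +_)
open import Data.List using (List; foldr; map; upTo)
open import Data.List.Membership.Propositional using (_∈_)
open import Data.List.Relation.Unary.Unique.Propositional using (Unique)
open import Data.Nat
open import Data.Nat.Combinatorics using (_C_; nC1≡n; nCk+nC[k+1]≡[n+1]C[k+1])
open import Data.Nat.Combinatorics.Specification using (k>n⇒nCk≡0)
open import Data.Nat.Divisibility using (_∣_; divides; ∣m+n∣m⇒∣n; m∣m*n)
open import Data.Nat.DivMod using (m/n*n≡m)
open import Data.Nat.Properties
open import Data.Nat.Tactic.RingSolver using (solve-∀)
open import Data.Product using (_×_; ∃-syntax)
open import Data.Vec as Vec using (Vec; []; _∷_; lookup; foldr′)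
open import Function.Bundles using (_⇔_)
open import Relation.Binary.PropositionalEquality
open import Relation.Nullary using (¬_)

private
  variable
    n k : ℕ

-- With 0-based positions the bound e_j ≤ j - 1 becomes lookup e j ≤ toℕ j.
IsInversionSequence : Vec ℕ n → Set
IsInversionSequence {n} e = ∀ (j : Fin n) → lookup e j ≤ toℕ j

-- The relation > is covered by exchanging a and b.
OrderIsomorphic : Vec ℕ k → Vec ℕ k → Set
OrderIsomorphic {k} u v = ∀ (a b : Fin k) →
  (lookup u a < lookup u b ⇔ lookup v a < lookup v b) ×
  (lookup u a ≡ lookup u b ⇔ lookup v a ≡ lookup v b)

Contains : Vec ℕ n → Vec ℕ 3 → Set
Contains {n} e w = ∃[ i₁ ] ∃[ i₂ ] ∃[ i₃ ]
  i₁ Fin.< i₂ × i₂ Fin.< i₃ ×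
  OrderIsomorphic (lookup e i₁ ∷ lookup e i₂ ∷ lookup e i₃ ∷ []) w

Avoids : Vec ℕ n → Vec ℕ 3 → Set
Avoids e w = ¬ Contains e w

max : Vec ℕ n → ℕ
max = foldr′ _⊔_ 0

-- The 1-based position p of the first descent e_p > e_{p+1}.  The clause for a
-- single entry implements the convention e_{n+1} = -1.  The value 0 on the
-- empty sequence is arbitrary.
fdes : Vec ℕ n → ℕ
fdes []          = 0
fdes (x ∷ [])    = 1
fdes (x ∷ y ∷ e) = if x ≤ᵇ y then suc (fdes (y ∷ e)) else 1

rank : Vec ℕ n → ℤ
rank e = + fdes e ℤ.- + max e ℤ.- + 1

-- xs lists every element satisfying P exactly once, so that the number of such
-- elements is length xs.
record Enumerates {A : Set} (P : A → Set) (xs : List A) : Set where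
  field
    unique : Unique xs
    member : ∀ x → x ∈ xs ⇔ P x

-- ∑[ i < m ] f i = f 0 + ... + f (m - 1).  A sum over 0 ≤ i ≤ u is the one with
-- m = u + 1; truncated subtraction in m gives 0 when u is negative.
sum< : ℕ → (ℕ → ℤ) → ℤ
sum< m f = foldr ℤ._+_ (+ 0) (map f (upTo m))

infix 6 sum<
syntax sum< m (λ i → x) = ∑[ i < m ] x

2j+k≢0 : ∀ j k .{{_ : NonZero k}} → NonZero (2 * j + k)
2j+k≢0 j k = >-nonZero (≤-trans (>-nonZero⁻¹ k) (m≤n+m k (2 * j)))

-- c j k = k / (2j + k) · binom(2j + k, j), the coefficient of x^j in C(x)^k.
-- The division is exact, see c-exact.
c : (j k : ℕ) .{{_ : NonZero k}} → ℕ
c j k = _/_ (k * ((2 * j + k) C j)) (2 * j + k) {{2j+k≢0 j k}}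

absorption : ∀ p i → suc i * (suc p C suc i) ≡ suc p * (p C i)
absorption p zero = trans (*-identityˡ (suc p C 1)) (trans (nC1≡n (suc p)) (sym (*-identityʳ (suc p))))
absorption zero (suc i) = begin
  suc (suc i) * (1 C suc (suc i)) ≡⟨ cong (suc (suc i) *_) (k>n⇒nCk≡0 {1} {suc (suc i)} (s≤s (s≤s z≤n))) ⟩
  suc (suc i) * 0                 ≡⟨ *-zeroʳ (suc (suc i)) ⟩
  0                               ≡⟨ cong (1 *_) (k>n⇒nCk≡0 {0} {suc i} (s≤s z≤n)) ⟨
  1 * (0 C suc i)                 ∎
  where open ≡-Reasoning
absorption (suc p) (suc i) = begin
  suc (suc i) * (suc (suc p) C suc (suc i))
    ≡⟨ cong (suc (suc i) *_) (nCk+nC[k+1]≡[n+1]C[k+1] (suc p) (suc i)) ⟨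
  suc (suc i) * (x + (suc p C suc (suc i)))
    ≡⟨ expand (suc i) x _ ⟩
  suc i * x + x + suc (suc i) * (suc p C suc (suc i))
    ≡⟨ cong₂ (λ u v → u + x + v) (absorption p i) (absorption p (suc i)) ⟩
  suc p * (p C i) + x + suc p * (p C suc i)
    ≡⟨ collect (suc p) (p C i) x (p C suc i) ⟩
  x + suc p * ((p C i) + (p C suc i))
    ≡⟨ cong (λ u → x + suc p * u) (nCk+nC[k+1]≡[n+1]C[k+1] p i) ⟩
  suc (suc p) * x ∎
  where
  open ≡-Reasoning
  x : ℕ
  x = suc p C suc i
  expand : ∀ a x y → suc a * (x + y) ≡ a * x + x + suc a * y
  expand = solve-∀
  collect : ∀ a y x z → a * y + x + a * z ≡ x + a * (y + z)
  collect = solve-∀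

2j+k∣k*C : ∀ j k → 2 * j + k ∣ k * ((2 * j + k) C j)
2j+k∣k*C zero    k = m∣m*n (k C 0)
2j+k∣k*C (suc i) k = ∣m+n∣m⇒∣n
  (subst (m ∣_) (*-distribʳ-+ B (2 * suc i) k) (m∣m*n B))
  (divides (2 * (p C i)) (begin
    2 * suc i * B                ≡⟨ *-assoc 2 (suc i) B ⟩
    2 * (suc i * B)              ≡⟨ cong (2 *_) (absorption p i) ⟩
    2 * (m * (p C i))            ≡⟨ swap m (p C i) ⟩
    2 * (p C i) * m              ∎))
  where
  open ≡-Reasoning
  m p B : ℕ
  m = 2 * suc i + k
  p = pred m
  B = m C suc i
  swap : ∀ m y → 2 * (m * y) ≡ 2 * y * m
  swap = solve-∀

c-exact : ∀ j k .{{_ : NonZero k}} → c j k * (2 * j + k) ≡ k * ((2 * j + k) C j)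
c-exact j k = m/n*n≡m {{2j+k≢0 j k}} (2j+k∣k*C j k)

{-# OPTIONS --safe #-}
-- Cut e at its first descent, so that e read backwards is s ++ b ∷ l, where
-- b = max(e) ends the weakly increasing prefix.  Avoidance says that the
-- entries of s other than b are sorted and that no entry of l lies strictly
-- between an entry y of the suffix and a later entry x > y.  Let a be the first
-- entry of the suffix.  Then either all entries of l are ≤ a or equal to b, and
-- copies of b may be interspersed in the suffix, or the suffix is sorted and
-- contained in [a , x], where x is the first entry of l above a.
--
-- Hence e is produced by a walk with a current level: a step raises the level,
-- pushes it onto the prefix, or puts it onto the suffix, the suffix being
-- written while the level climbs away from a.  The parameters of a walk are its
-- weight N = level + |s| and its height k = |l| − level; at the end N = n − t − 1
-- and k = t.  Removing the last step gives recursions in (N , k) whose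
-- solutions are coefficients of C(x)ᵏ and of C(x)ᵏ / √(1 − 4x).
module Submission where

open import Defs
open import Data.Bool using (true; false; if_then_else_)
open import Data.Empty using (⊥; ⊥-elim)
open import Data.Fin as Fin using (Fin; zero; suc; toℕ)
open import Data.Integer as ℤ using (ℤ; +_)
import Data.Integer.Properties as ℤ
import Data.Integer.Tactic.RingSolver as ℤ
open import Data.List using (List; []; _∷_; length; map; _++_; reverse; _ʳ++_; foldr; upTo; applyUpTo)
open import Data.List.Membership.Propositional using (_∈_)
open import Data.List.Membership.Propositional.Properties using (∈-map⁺; ∈-map⁻; ∈-++⁺ˡ; ∈-++⁺ʳ; ∈-++⁻)
open import Data.List.Properties
  using ( map-upTo; map-cong; map-∘; length-map; length-++; length-reverse; reverse-injective; reverse-involutive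
        ; unfold-reverse; ++-ʳ++; ∷-injectiveˡ; ∷-injectiveʳ )
open import Data.List.Relation.Binary.Sublist.Propositional using (_⊆_; []; _∷_; _∷ʳ_; minimum; ⊆-trans; from∈; to∈)
open import Data.List.Relation.Binary.Sublist.Propositional.Properties using (∷ˡ⁻; ++⁺; reverse⁺; reverse⁻)
open import Data.List.Relation.Unary.All as All using (All; []; _∷_)
import Data.List.Relation.Unary.All.Properties as All
open import Data.List.Relation.Unary.AllPairs as AllPairs using (AllPairs; []; _∷_)
import Data.List.Relation.Unary.AllPairs.Properties as AllPairs
open import Data.List.Relation.Unary.Any using (here; there)
import Data.List.Relation.Unary.Any.Properties as Any
open import Data.List.Relation.Unary.Unique.Propositional using (Unique)
import Data.List.Relation.Unary.Unique.Propositional.Properties as Unique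
open import Data.Maybe using (Maybe; just; nothing; fromMaybe)
open import Data.Nat
open import Data.Nat.Combinatorics using (_C_; nCk≡nC[n∸k]; nCk+nC[k+1]≡[n+1]C[k+1])
open import Data.Nat.Properties
open import Data.Nat.Tactic.RingSolver using (solve-∀)
open import Data.Product using (_×_; _,_; proj₁; proj₂; ∃-syntax)
open import Data.Sum using (_⊎_; inj₁; inj₂; [_,_]′)
open import Data.Unit using (⊤)
open import Data.Vec as Vec using (Vec; []; _∷_; lookup; toList; fromList)
import Data.Vec.Properties as Vec
open import Function using (_∘_; id)
open import Function.Bundles using (_⇔_; mk⇔; Equivalence)
open import Relation.Binary.PropositionalEquality
open import Relation.Nullary using (¬_; yes; no)

-- Catalan identities

sumℕ< : (ℕ → ℕ) → ℕ → ℕ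
sumℕ< f zero    = 0
sumℕ< f (suc n) = f 0 + sumℕ< (f ∘ suc) n

sumℕ<-snoc : ∀ f n → sumℕ< f (suc n) ≡ sumℕ< f n + f n
sumℕ<-snoc f zero    = +-comm (f 0) 0
sumℕ<-snoc f (suc n) = trans (cong (_+_ (f 0)) (sumℕ<-snoc (f ∘ suc) n)) (sym (+-assoc (f 0) _ _))

sumℕ<-+ : ∀ f g n → sumℕ< (λ i → f i + g i) n ≡ sumℕ< f n + sumℕ< g n
sumℕ<-+ f g zero    = refl
sumℕ<-+ f g (suc n) = trans (cong (_+_ (f 0 + g 0)) (sumℕ<-+ (f ∘ suc) (g ∘ suc) n)) (interchange (f 0) (g 0) _ _)
  where
  interchange : ∀ a b c d → a + b + (c + d) ≡ a + c + (b + d)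
  interchange = solve-∀

-- Proves x ≡ y from an equation l ≡ r of which it is a linear consequence, the
-- remaining identity being left to the ring solver.
from-equation : ∀ {l r x y} → l ≡ r → x + r ≡ y + l → x ≡ y
from-equation {l} refl e = +-cancelʳ-≡ l _ _ e

-- cat i k = [x^i] C(x)^k, by C^(k+1) = C^k + x C^(k+2).
cat : ℕ → ℕ → ℕ
cat zero    k       = 1
cat (suc i) zero    = 0
cat (suc i) (suc k) = cat (suc i) k + cat i (2 + k)

-- central i k = [x^i] C(x)^k / √(1 - 4x)
central : ℕ → ℕ → ℕ
central i k = (2 * i + k) C i

2*[1+i]+k : ∀ i k → 2 * suc i + k ≡ 2 * i + (2 + k)
2*[1+i]+k = solve-∀

central-suc : ∀ i k → central (suc i) (suc k) ≡ central (suc i) k + central i (2 + k)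
central-suc i k = begin
  (2 * suc i + suc k) C suc i
    ≡⟨ cong (_C suc i) (+-suc (2 * suc i) k) ⟩
  suc (2 * suc i + k) C suc i
    ≡⟨ nCk+nC[k+1]≡[n+1]C[k+1] (2 * suc i + k) i ⟨
  (2 * suc i + k) C i + central (suc i) k
    ≡⟨ +-comm _ (central (suc i) k) ⟩
  central (suc i) k + (2 * suc i + k) C i
    ≡⟨ cong (λ m → central (suc i) k + m C i) (2*[1+i]+k i k) ⟩
  central (suc i) k + central i (2 + k) ∎
  where open ≡-Reasoning

-- Coefficient form of `1/√(1 - 4x) = 1 + 2x C(x)/√(1 - 4x)`, the case `k = 0` that `central-suc`
-- does not reach: in the middle of a row the two terms of Pascal's rule are equal.
central-suc-zero : ∀ i → central (suc i) 0 ≡ central i 1 + central i 1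
central-suc-zero i = begin
  (2 * suc i + 0) C suc i
    ≡⟨ cong (_C suc i) (expand i) ⟩
  suc (i + suc i) C suc i
    ≡⟨ nCk+nC[k+1]≡[n+1]C[k+1] (i + suc i) i ⟨
  (i + suc i) C i + (i + suc i) C suc i
    ≡⟨ cong (_+_ ((i + suc i) C i)) (nCk≡nC[n∸k] (m≤n+m (suc i) i)) ⟩
  (i + suc i) C i + (i + suc i) C (i + suc i ∸ suc i)
    ≡⟨ cong (λ j → (i + suc i) C i + (i + suc i) C j) (m+n∸n≡m i (suc i)) ⟩
  (i + suc i) C i + (i + suc i) C i
    ≡⟨ cong (λ m → m C i + m C i) (odd i) ⟩
  central i 1 + central i 1 ∎
  where
  open ≡-Reasoning
  expand : ∀ i → 2 * suc i + 0 ≡ suc (i + suc i)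
  expand = solve-∀
  odd : ∀ i → i + suc i ≡ 2 * i + 1
  odd = solve-∀

-- Coefficient form of `C(x)^(k+1) = (1 - x C(x)^2) C(x)^k / √(1 -
-- 4x)`. All terms obey the recursion `C^(k+1) = C^k + x C^(k+2)`, so only the initial values and
-- the symmetry at `k = 0` need work.
cat-central : ∀ i k → cat (suc i) (suc k) + central i (2 + k) ≡ central (suc i) k
cat-central zero    zero    = refl
cat-central zero    (suc k) = trans (cong (_+ 1) (cat-central zero k)) (sym (central-suc zero k))
cat-central (suc i) zero    = begin
  q + central (suc i) 2  ≡⟨ cong (_+_ q) (central-suc i 1) ⟩
  q + (x + y)            ≡⟨ regroup q x y ⟩
  x + (q + y)            ≡⟨ cong (_+_ x) (cat-central i 1) ⟩
  x + x                  ≡⟨ central-suc-zero (suc i) ⟨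
  central (2 + i) 0      ∎
  where
  open ≡-Reasoning
  q x y : ℕ
  q = cat (suc i) 2
  x = central (suc i) 1
  y = central i 3
  regroup : ∀ q x y → q + (x + y) ≡ x + (q + y)
  regroup = solve-∀
cat-central (suc i) (suc k) = begin
  p + q + central (suc i) (3 + k)  ≡⟨ cong (_+_ (p + q)) (central-suc i (2 + k)) ⟩
  p + q + (x + y)                  ≡⟨ regroup p q x y ⟩
  (p + x) + (q + y)                ≡⟨ cong₂ _+_ (cat-central (suc i) k) (cat-central i (2 + k)) ⟩
  central (2 + i) k + x            ≡⟨ central-suc (suc i) k ⟨
  central (2 + i) (suc k)          ∎
  where
  open ≡-Reasoning
  p q x y : ℕ
  p = cat (2 + i) (suc k)
  q = cat (suc i) (3 + k)
  x = central (suc i) (2 + k)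
  y = central i (4 + k)
  regroup : ∀ p q x y → p + q + (x + y) ≡ (p + x) + (q + y)
  regroup = solve-∀

-- With `w`, `u` and `x` as below, Pascal's rule and `cat-central` give `x = w + 2u`, and absorption
-- gives `(i + 1) x = (p + 1) u`. Eliminating `u` leaves the ballot formula.
cat-exact : ∀ i k → cat i k * (2 * i + k) ≡ k * ((2 * i + k) C i)
cat-exact zero    k       = *-comm 1 k
cat-exact (suc i) zero    = refl
cat-exact (suc i) (suc k) = subst (λ m → cat (suc i) (suc k) * m ≡ suc k * (m C suc i))
  (sym (+-suc (2 * suc i) k)) (+-cancelʳ-≡ (2 * (suc i * x)) _ _ (begin
  w * suc p + 2 * (suc i * x)          ≡⟨ cong (λ z → w * suc p + 2 * z) (absorption p i) ⟩
  w * suc p + 2 * (suc p * u)          ≡⟨ regroup w (suc p) u ⟩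
  suc p * (u + (w + u))                ≡⟨ cong (λ z → suc p * (u + z)) w+u ⟩
  suc p * (u + (p C suc i))            ≡⟨ cong (suc p *_) (nCk+nC[k+1]≡[n+1]C[k+1] p i) ⟩
  suc p * x                            ≡⟨ expand i k x ⟩
  suc k * x + 2 * (suc i * x)          ∎))
  where
  open ≡-Reasoning
  p w u x : ℕ
  p = 2 * suc i + k
  w = cat (suc i) (suc k)
  u = p C i
  x = suc p C suc i
  w+u : w + u ≡ p C suc i
  w+u = trans (cong (λ m → w + m C i) (2*[1+i]+k i k)) (cat-central i k)
  regroup : ∀ w m u → w * m + 2 * (m * u) ≡ m * (u + (w + u))
  regroup = solve-∀
  expand : ∀ i k x → suc (2 * suc i + k) * x ≡ suc k * x + 2 * (suc i * x)
  expand = solve-∀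

c≡cat : ∀ j k .{{_ : NonZero k}} → c j k ≡ cat j k
c≡cat j k = *-cancelʳ-≡ (c j k) (cat j k) (2 * j + k) {{2j+k≢0 j k}}
  (trans (c-exact j k) (sym (cat-exact j k)))

-- q i k = [x^i] of (k + 1) C^(k+3) / √(1 - 4x) - C^(k+4)
q : ℕ → ℕ → ℕ
q zero    k       = k
q (suc i) zero    = q i 1
q (suc i) (suc k) = q (suc i) k + (cat (suc i) (4 + k) + q i (2 + k))

q-closed : ∀ i k → q i k + cat i (4 + k) ≡ suc k * central i (3 + k)
q-closed zero    k       = trans (+-comm k 1) (sym (*-identityʳ (suc k)))
q-closed (suc i) zero    = begin
  q i 1 + (c₃ + cat i 5)             ≡⟨ regroup (q i 1) c₃ (cat i 5) ⟩
  (q i 1 + cat i 5) + c₃             ≡⟨ cong (_+ c₃) (q-closed i 1) ⟩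
  2 * v + c₃                         ≡⟨ regroup′ v c₃ ⟩
  1 * ((c₃ + v) + v)                 ≡⟨ cong (λ z → 1 * (z + v)) (cat-central i 2) ⟩
  1 * (central (suc i) 2 + v)        ≡⟨ cong (1 *_) (central-suc i 2) ⟨
  1 * central (suc i) 3              ∎
  where
  open ≡-Reasoning
  c₃ v : ℕ
  c₃ = cat (suc i) 3
  v = central i 4
  regroup : ∀ x y z → x + (y + z) ≡ x + z + y
  regroup = solve-∀
  regroup′ : ∀ v c → 2 * v + c ≡ 1 * (c + v + v)
  regroup′ = solve-∀
q-closed (suc i) (suc k) = begin
  q₁ + (c₄ + q₂) + (c₄ + c₅)               ≡⟨ regroup q₁ c₄ q₂ c₅ ⟩
  (q₁ + c₄) + (q₂ + c₅) + c₄               ≡⟨ cong₂ (λ x y → x + y + c₄) (q-closed (suc i) k) (q-closed i (2 + k)) ⟩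
  suc k * x + (3 + k) * v + c₄             ≡⟨ regroup′ k x v c₄ ⟩
  -- One `v` joins `c₄` to form another `x`, so that the factors `k + 1` of `x` and `k + 3` of `v`
  -- both become `k + 2`.
  suc k * x + (2 + k) * v + (c₄ + v)       ≡⟨ cong (_+_ (suc k * x + (2 + k) * v)) (cat-central i (3 + k)) ⟩
  suc k * x + (2 + k) * v + x              ≡⟨ regroup″ k x v ⟩
  (2 + k) * (x + v)                        ≡⟨ cong ((2 + k) *_) (central-suc i (3 + k)) ⟨
  (2 + k) * central (suc i) (4 + k)        ∎
  where
  open ≡-Reasoning
  q₁ q₂ c₄ c₅ x v : ℕ
  q₁ = q (suc i) k
  q₂ = q i (2 + k)
  c₄ = cat (suc i) (4 + k)
  c₅ = cat i (6 + k)
  x = central (suc i) (3 + k)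
  v = central i (5 + k)
  regroup : ∀ a b c d → a + (b + c) + (b + d) ≡ (a + b) + (c + d) + b
  regroup = solve-∀
  regroup′ : ∀ k x v c → suc k * x + (3 + k) * v + c ≡ suc k * x + (2 + k) * v + (c + v)
  regroup′ = solve-∀
  regroup″ : ∀ k x v → suc k * x + (2 + k) * v + x ≡ (2 + k) * (x + v)
  regroup″ = solve-∀

-- Recursions and closed forms for the numbers of walks

#T : ℕ → ℕ → ℕ
#T zero    k = 0
#T (suc N) k = cat N (3 + k)

#T₁ : ℕ → ℕ → ℕ
#T₁ zero    k = 0
#T₁ (suc N) k = sumℕ< (λ i → cat i (4 + k)) N

#Q : ℕ → ℕ → ℕ
#Q zero    k = 0
#Q (suc N) k = sumℕ< (λ i → q i k) N

-- In the last clause the summands stand for a last push and for a last raise from a `Path`, a `V`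
-- and a `Q`, in this order.
#final : ℕ → ℕ → ℕ
#final zero    t       = 1
#final (suc N) zero    = cat N 2 + (#T N 2 + #Q N 1)
#final (suc N) (suc t) = #final (suc N) t + (cat N (3 + t) + (#T N (3 + t) + #Q N (2 + t)))

-- The recursion of `cat` unfolded twice. The summands are the counts for the possible last steps of
-- `T`, and again for those of `V₀`.
#T-suc : ∀ N k → cat N (suc k) + (#T N k + #T N (suc k)) ≡ #T (suc N) k
#T-suc zero    k = refl
#T-suc (suc N) k = sym (+-assoc (cat (suc N) (suc k)) (cat N (3 + k)) (cat N (4 + k)))

#T₁-suc : ∀ N k → #T N (suc k) + #T₁ N k ≡ #T₁ (suc N) k
#T₁-suc zero    k = refl
#T₁-suc (suc N) k = trans (+-comm (cat N (4 + k)) _) (sym (sumℕ<-snoc (λ i → cat i (4 + k)) N))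

#Q-zero : ∀ N → #Q N 1 ≡ #Q (suc N) 0
#Q-zero zero    = refl
#Q-zero (suc N) = refl

-- The recursion of `q` summed over its first argument. The initial term grows from `k` to `k + 1`
-- by the leading 1 of `#T₁`.
#Q-suc : ∀ N k → #Q (suc N) k + (#T₁ (suc N) k + #Q N (2 + k)) ≡ #Q (suc N) (suc k)
#Q-suc zero    k = refl
#Q-suc (suc N) k = begin
  k + sumℕ< q₁ N + (1 + sumℕ< c₄ N + sumℕ< q₂ N)          ≡⟨ regroup k (sumℕ< q₁ N) (sumℕ< c₄ N) (sumℕ< q₂ N) ⟩
  suc k + (sumℕ< q₁ N + (sumℕ< c₄ N + sumℕ< q₂ N))        ≡⟨ cong (λ z → suc k + (sumℕ< q₁ N + z)) (sumℕ<-+ c₄ q₂ N) ⟨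
  suc k + (sumℕ< q₁ N + sumℕ< (λ i → c₄ i + q₂ i) N)  ≡⟨ cong (_+_ (suc k)) (sumℕ<-+ q₁ (λ i → c₄ i + q₂ i) N) ⟨
  suc k + sumℕ< (λ i → q (suc i) (suc k)) N       ∎
  where
  open ≡-Reasoning
  q₁ q₂ c₄ : ℕ → ℕ
  q₁ i = q (suc i) k
  q₂ i = q i (2 + k)
  c₄ i = cat (suc i) (4 + k)
  regroup : ∀ k a b c → k + a + (1 + b + c) ≡ suc k + (a + (b + c))
  regroup = solve-∀

#T-suc′ : ∀ N k → #T (suc N) k + #T N (2 + k) ≡ #T (suc N) (suc k)
#T-suc′ zero    k = refl
#T-suc′ (suc N) k = refl

-- The increment of the closed form at weight `M + 2` from height `k - 1` to `k`, less the part
-- settled by the recursion of `cat`. At `k = 0` it gives the value at height 0: the sum with factor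
-- `k` vanishes, and the other sum on the left is the one subtracted in the formula.
#final-step : ∀ M k →
  cat M (5 + k) + sumℕ< (λ i → q i (suc k)) M + k * sumℕ< (λ i → central i (2 + k)) (suc M) + sumℕ< (λ i → cat i (5 + k)) M
    ≡ suc k * sumℕ< (λ i → central i (3 + k)) (suc M) + sumℕ< (λ i → cat i (6 + k)) M
#final-step zero    k = base k
  where
  base : ∀ k → 1 + 0 + k * (1 + 0) + 0 ≡ suc k * (1 + 0) + 0
  base = solve-∀
#final-step (suc M) k = begin
  cat (suc M) (5 + k) + sumℕ< q₁ (suc M) + k * sumℕ< b₂ (2 + M) + sumℕ< c₅ (suc M)
    ≡⟨ cong₂ _+_ (cong₂ _+_ (cong (_+_ (cat (suc M) (5 + k))) (sumℕ<-snoc q₁ M)) (cong (k *_) (sumℕ<-snoc b₂ (suc M)))) (sumℕ<-snoc c₅ M) ⟩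
  cat (suc M) (5 + k) + (sumℕ< q₁ M + q₁ M) + k * (sumℕ< b₂ (suc M) + b₂ (suc M)) + (sumℕ< c₅ M + c₅ M)
    ≡⟨ from-equation
         -- The terms added in passing from `M` to `M + 1` balance by `q-closed`, by `central-suc`
         -- taken `k + 1` times, and by `cat-central`.
         (cong₂ _+_ (#final-step M k) (cong₂ _+_ (q-closed M (suc k))
           (cong₂ _+_ (cong (suc k *_) (sym (central-suc M (2 + k)))) (cat-central M (2 + k)))))
         (regroup k (c₅ M) (c₆ M) (cat (suc M) (3 + k)) (sumℕ< q₁ M) (q₁ M) (sumℕ< b₂ (suc M)) (b₂ (suc M)) (b₃ (suc M))
           (central M (4 + k)) (sumℕ< c₅ M) (sumℕ< b₃ (suc M)) (sumℕ< c₆ M)) ⟩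
  suc k * (sumℕ< b₃ (suc M) + b₃ (suc M)) + (sumℕ< c₆ M + c₆ M)
    ≡⟨ cong₂ _+_ (cong (suc k *_) (sumℕ<-snoc b₃ (suc M))) (sumℕ<-snoc c₆ M) ⟨
  suc k * sumℕ< b₃ (2 + M) + sumℕ< c₆ (suc M) ∎
  where
  open ≡-Reasoning
  q₁ b₂ b₃ c₅ c₆ : ℕ → ℕ
  q₁ i = q i (suc k)
  b₂ i = central i (2 + k)
  b₃ i = central i (3 + k)
  c₅ i = cat i (5 + k)
  c₆ i = cat i (6 + k)
  regroup : ∀ k c₅ c₆ c₃ σq q σb b₂ b₃ v σc₅ σb₃ σc₆ →
    ((c₃ + c₅) + c₆) + (σq + q) + k * (σb + b₂) + (σc₅ + c₅) + (suc k * σb₃ + σc₆ + (suc (suc k) * v + (suc k * b₃ + b₂)))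
      ≡ suc k * (σb₃ + b₃) + (σc₆ + c₆) + (c₅ + σq + k * σb + σc₅ + (q + c₅ + (suc k * (b₂ + v) + (c₃ + v))))
  regroup = solve-∀

-- The subtracted sum stands on the left to keep the identity in ℕ. Weights 0 and 1, at which all
-- sums are empty by truncated subtraction, are treated apart.
#final-closed : ∀ N t →
  #final N t + sumℕ< (λ i → cat i 5) (N ∸ 2)
    ≡ cat N (suc t) + suc t * sumℕ< (λ i → central i (3 + t)) (N ∸ 1) + sumℕ< (λ i → cat i (6 + t)) (N ∸ 2)
#final-closed zero          t       = cong (λ z → 1 + z + 0) (sym (*-zeroʳ t))
#final-closed (suc zero)    zero    = refl
#final-closed (suc zero)    (suc t) = trans (cong (_+ 0) (from-equation (#final-closed 1 t) (regroup (#final 1 t) (cat 1 t) t))) refl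
  where
  regroup : ∀ f w t → f + 1 + (w + 1 + suc t * 0 + 0) ≡ w + 1 + 1 + suc (suc t) * 0 + (f + 0)
  regroup = solve-∀
#final-closed (suc (suc M)) zero    = from-equation (#final-step M 0)
  (regroup (cat (suc M) 2) (cat M 5) (sumℕ< (λ i → q i 1) M) (sumℕ< (λ i → cat i 5) M)
    (sumℕ< (λ i → central i 3) (suc M)) (sumℕ< (λ i → cat i 6) M))
  where
  regroup : ∀ c₂ c₅ σq σc₅ σb₃ σc₆ →
    c₂ + (c₅ + σq) + σc₅ + (1 * σb₃ + σc₆) ≡ c₂ + 1 * σb₃ + σc₆ + (c₅ + σq + 0 + σc₅)
  regroup = solve-∀
#final-closed (suc (suc M)) (suc t) = from-equation (cong₂ _+_ (#final-closed (2 + M) t) (#final-step M (suc t)))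
  (regroup t (#final (2 + M) t) (cat (2 + M) (suc t)) (cat (suc M) (3 + t)) (cat M (6 + t)) (sumℕ< (λ i → q i (2 + t)) M)
    (sumℕ< (λ i → cat i 5) M) (sumℕ< (λ i → cat i (6 + t)) M) (sumℕ< (λ i → cat i (7 + t)) M)
    (sumℕ< (λ i → central i (3 + t)) (suc M)) (sumℕ< (λ i → central i (4 + t)) (suc M)))
  where
  regroup : ∀ t f w c₃ c₆ σq σc₅ σc₆ σc₇ σb₃ σb₄ →
    f + (c₃ + (c₆ + σq)) + σc₅ + (w + suc t * σb₃ + σc₆ + (suc (suc t) * σb₄ + σc₇))
      ≡ w + c₃ + suc (suc t) * σb₄ + σc₇ + (f + σc₅ + (c₆ + σq + suc t * σb₃ + σc₆))
  regroup = solve-∀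

-- Passage to integer sums

sum<≡sumℕ< : ∀ m (f : ℕ → ℕ) → sum< m (λ i → + f i) ≡ + sumℕ< f m
sum<≡sumℕ< m f = trans (cong (foldr ℤ._+_ (+ 0)) (map-upTo (λ i → + f i) m)) (go m f)
  where
  go : ∀ m f → foldr ℤ._+_ (+ 0) (applyUpTo (λ i → + f i) m) ≡ + sumℕ< f m
  go zero    f = refl
  go (suc m) f = cong (ℤ._+_ (+ f 0)) (go m (f ∘ suc))

sum<-cong : ∀ m {f g : ℕ → ℤ} → (∀ i → f i ≡ g i) → sum< m f ≡ sum< m g
sum<-cong m f≡g = cong (foldr ℤ._+_ (+ 0)) (map-cong f≡g (upTo m))

sum<-minus : ∀ m (f g : ℕ → ℕ) → sum< m (λ i → + f i ℤ.- + g i) ≡ + sumℕ< f m ℤ.- + sumℕ< g m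
sum<-minus m f g = trans (cong (foldr ℤ._+_ (+ 0)) (map-upTo (λ i → + f i ℤ.- + g i) m)) (go m f g)
  where
  interchange : ∀ a b c d → (a ℤ.- b) ℤ.+ (c ℤ.- d) ≡ (a ℤ.+ c) ℤ.- (b ℤ.+ d)
  interchange = ℤ.solve-∀
  go : ∀ m f g → foldr ℤ._+_ (+ 0) (applyUpTo (λ i → + f i ℤ.- + g i) m) ≡ + sumℕ< f m ℤ.- + sumℕ< g m
  go zero    f g = refl
  go (suc m) f g = trans (cong (ℤ._+_ (+ f 0 ℤ.- + g 0)) (go m (f ∘ suc) (g ∘ suc)))
    (interchange (+ f 0) (+ g 0) (+ sumℕ< (f ∘ suc) m) (+ sumℕ< (g ∘ suc) m))

closed-form : ∀ N t →
  + #final N t ≡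
    + c N (suc t)
    ℤ.+ + suc t ℤ.* (∑[ i < N ∸ 1 ] (+ ((2 * i + t + 3) C i)))
    ℤ.+ (∑[ i < N ∸ 2 ] (+ c i (6 + t) ℤ.- + c i 5))
closed-form N t = begin
  + #final N t
    ≡⟨ move (+ #final N t) (+ sumℕ< (λ i → cat i 5) (N ∸ 2)) ⟩
  + (#final N t + sumℕ< (λ i → cat i 5) (N ∸ 2)) ℤ.- + s₅
    ≡⟨ cong (λ z → + z ℤ.- + s₅) (#final-closed N t) ⟩
  + (cat N (suc t) + suc t * s₃ + s₆) ℤ.- + s₅
    ≡⟨ cong (λ z → + cat N (suc t) ℤ.+ z ℤ.+ + s₆ ℤ.- + s₅) (ℤ.pos-* (suc t) s₃) ⟩
  + cat N (suc t) ℤ.+ + suc t ℤ.* + s₃ ℤ.+ + s₆ ℤ.- + s₅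
    ≡⟨ ℤ.+-assoc (+ cat N (suc t) ℤ.+ + suc t ℤ.* + s₃) (+ s₆) (ℤ.- + s₅) ⟩
  + cat N (suc t) ℤ.+ + suc t ℤ.* + s₃ ℤ.+ (+ s₆ ℤ.- + s₅)
    ≡⟨ cong₂ ℤ._+_ (cong₂ (λ x y → + x ℤ.+ + suc t ℤ.* y) (c≡cat N (suc t)) centrals) cats ⟨
  + c N (suc t)
    ℤ.+ + suc t ℤ.* (∑[ i < N ∸ 1 ] (+ ((2 * i + t + 3) C i)))
    ℤ.+ (∑[ i < N ∸ 2 ] (+ c i (6 + t) ℤ.- + c i 5)) ∎
  where
  open ≡-Reasoning
  s₃ s₅ s₆ : ℕ
  s₃ = sumℕ< (λ i → central i (3 + t)) (N ∸ 1)
  s₅ = sumℕ< (λ i → cat i 5) (N ∸ 2)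
  s₆ = sumℕ< (λ i → cat i (6 + t)) (N ∸ 2)
  move : ∀ a b → a ≡ (a ℤ.+ b) ℤ.- b
  move = ℤ.solve-∀
  shift : ∀ i t → 2 * i + t + 3 ≡ 2 * i + (3 + t)
  shift = solve-∀
  centrals : sum< (N ∸ 1) (λ i → + ((2 * i + t + 3) C i)) ≡ + s₃
  centrals = trans (sum<-cong (N ∸ 1) (λ i → cong (λ m → + (m C i)) (shift i t)))
    (sum<≡sumℕ< (N ∸ 1) (λ i → central i (3 + t)))
  cats : sum< (N ∸ 2) (λ i → + c i (6 + t) ℤ.- + c i 5) ≡ + s₆ ℤ.- + s₅
  cats = trans (sum<-cong (N ∸ 2) (λ i → cong₂ (λ x y → + x ℤ.- + y) (c≡cat i (6 + t)) (c≡cat i 5)))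
    (sum<-minus (N ∸ 2) (λ i → cat i (6 + t)) (λ i → cat i 5))

-- Counting by disjoint unions and images

Counted : {A : Set} → (A → Set) → ℕ → Set
Counted P m = ∃[ xs ] Enumerates P xs × length xs ≡ m

module _ {A : Set} where

  counted-∅ : {P : A → Set} → (∀ x → ¬ P x) → Counted P 0
  counted-∅ ¬P = [] , record { unique = [] ; member = λ x → mk⇔ (λ ()) (⊥-elim ∘ ¬P x) } , refl

  counted-≡ : ∀ y → Counted {A} (_≡ y) 1
  counted-≡ y = y ∷ [] , record { unique = [] ∷ [] ; member = λ x → mk⇔ (λ { (here e) → e ; (there ()) }) here } , refl

  counted-≐ : ∀ {P Q : A → Set} {m} → (∀ {x} → P x → Q x) → (∀ {x} → Q x → P x) → Counted P m → Counted Q m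
  counted-≐ P⊆Q Q⊆P (xs , enum , len) = xs , record
    { unique = unique
    ; member = λ x → mk⇔ (P⊆Q ∘ Equivalence.to (member x)) (Equivalence.from (member x) ∘ Q⊆P)
    } , len
    where open Enumerates enum

  counted-⊎ : ∀ {P Q : A → Set} {m n} → Counted P m → Counted Q n →
              (∀ {x} → P x → Q x → ⊥) → Counted (λ x → P x ⊎ Q x) (m + n)
  counted-⊎ (xs , enumP , refl) (ys , enumQ , refl) disjoint = xs ++ ys , record
    { unique = Unique.++⁺ P.unique Q.unique
        (λ (x∈xs , x∈ys) → disjoint (Equivalence.to (P.member _) x∈xs) (Equivalence.to (Q.member _) x∈ys))
    ; member = λ x → mk⇔
        ([ inj₁ ∘ Equivalence.to (P.member x) , inj₂ ∘ Equivalence.to (Q.member x) ]′ ∘ ∈-++⁻ xs)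
        [ ∈-++⁺ˡ ∘ Equivalence.from (P.member x) , ∈-++⁺ʳ xs ∘ Equivalence.from (Q.member x) ]′
    } , length-++ xs
    where
    module P = Enumerates enumP
    module Q = Enumerates enumQ

  module _ {B : Set} where

    -- Injectivity is asked on `P` alone: `finishₛ` and `flat` are injective only on the outputs of
    -- walks.
    counted-image : ∀ {P : A → Set} {m} (f : A → B) → (∀ {x y} → P x → P y → f x ≡ f y → x ≡ y) →
                    Counted P m → Counted (λ y → ∃[ x ] P x × y ≡ f x) m
    counted-image {P} f injective (xs , enum , len) = map f xs , record
      { unique = unique-map xs (λ x∈xs → Equivalence.to (member _) x∈xs) unique
      ; member = λ y → mk⇔
          (λ y∈ → let x , x∈xs , y≡fx = ∈-map⁻ f y∈ in x , Equivalence.to (member x) x∈xs , y≡fx)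
          (λ { (x , Px , refl) → ∈-map⁺ f (Equivalence.from (member x) Px) })
      } , trans (length-map f xs) len
      where
      open Enumerates enum
      unique-map : ∀ xs → (∀ {x} → x ∈ xs → P x) → Unique xs → Unique (map f xs)
      unique-map []       all-P []            = []
      unique-map (x ∷ xs) all-P (x∉xs ∷ uniq) =
        All.tabulate (λ y∈ fx≡y → let z , z∈xs , y≡fz = ∈-map⁻ f y∈ in
          All.lookup x∉xs z∈xs (injective (all-P (here refl)) (all-P (there z∈xs)) (trans fx≡y y≡fz)))
        ∷ unique-map xs (all-P ∘ there) uniq

    counted-preimage : ∀ {Q : B → Set} {m} (g : A → B) → (∀ {x y} → g x ≡ g y → x ≡ y) →
                       (∀ {y} → Q y → ∃[ x ] g x ≡ y) → Counted Q m → Counted (Q ∘ g) m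
    counted-preimage {Q} g injective surjective (ys , enum , len) with lift ys (λ y∈ → Equivalence.to (member _) y∈)
      where
      open Enumerates enum
      lift : ∀ ys → (∀ {y} → y ∈ ys → Q y) → ∃[ xs ] map g xs ≡ ys
      lift []       all-Q = [] , refl
      lift (y ∷ ys) all-Q with surjective (all-Q (here refl)) | lift ys (all-Q ∘ there)
      ... | x , refl | xs , refl = x ∷ xs , refl
    ... | xs , refl = xs , record
      { unique = Unique.map⁻ unique
      ; member = λ x → mk⇔ (Equivalence.to (member (g x)) ∘ ∈-map⁺ g)
          (λ Qgx → let x′ , x′∈xs , gx≡gx′ = ∈-map⁻ g (Equivalence.from (member (g x)) Qgx) in
            subst (_∈ xs) (sym (injective gx≡gx′)) x′∈xs)
      } , trans (sym (length-map g xs)) len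
      where open Enumerates enum

-- Walks

private
  variable
    a b d x y z k m n t N : ℕ
    l s r : List ℕ
    s? : List (Maybe ℕ)

-- Throughout, lists hold the entries of an inversion sequence in reverse order.
data Asc : ℕ → List ℕ → Set where
  []  : Asc b []
  _∷⟨_⟩_ : x ≤ b → x ≤ length l → Asc x l → Asc b (x ∷ l)

-- `a` ends the list, so it is the first entry of the suffix, and its least.
data Suf (a : ℕ) : ℕ → List ℕ → Set where
  [_] : a ≤ b → Suf a b (a ∷ [])
  _∷_ : x ≤ b → Suf a x s → Suf a b (x ∷ s)

-- The copies of the maximum are represented by nothing, since the maximum is not
-- yet known while the suffix is being written.
data Mix (a : ℕ) : ℕ → List (Maybe ℕ) → Set where
  [_]  : a ≤ b → Mix a b (just a ∷ [])
  _∷_  : x ≤ b → Mix a x s? → Mix a b (just x ∷ s?)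
  mark : Mix a b s? → Mix a b (nothing ∷ s?)

-- The entries of l are ≤ a, or they lie above the whole suffix s; the latter occur.
data Jump (a : ℕ) (s : List ℕ) : ℕ → List ℕ → Set where
  jump : x ≤ b → x ≤ length l → a < x → Suf a x s → Asc a l → Jump a s b (x ∷ l)
  _∷⟨_⟩_ : x ≤ b → x ≤ length l → Jump a s x l → Jump a s b (x ∷ l)

-- Ballot paths. A raise consumes height, which keeps the level at most the length of the prefix:
-- this is the inversion bound for the entry pushed next.
data Path : ℕ → ℕ → List ℕ → Set where
  start : Path 0 0 []
  push  : Path N k l → Path N (suc k) (N ∷ l)
  raise : Path N (suc k) l → Path (suc N) k l

-- (level , prefix , suffix)
State : Set → Set
State A = ℕ × List ℕ × List A

-- T writes a sorted suffix, T₁ requires in addition that the level has been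
-- raised since the first entry, and Q resumes the prefix after T₁.
data T : ℕ → ℕ → State ℕ → Set where
  put₁  : Path N k l → T (suc N) k (N , l , N ∷ [])
  put   : T N k (b , l , s) → T (suc N) k (b , l , b ∷ s)
  raise : T N (suc k) (b , l , s) → T (suc N) k (suc b , l , s)

data T₁ : ℕ → ℕ → State ℕ → Set where
  put   : T₁ N k (b , l , s) → T₁ (suc N) k (b , l , b ∷ s)
  raise : T N (suc k) (b , l , s) → T₁ (suc N) k (suc b , l , s)

data Q : ℕ → ℕ → State ℕ → Set where
  push₁ : T₁ N k (b , l , s) → Q N (suc k) (b , b ∷ l , s)
  push  : Q N k (b , l , s) → Q N (suc k) (b , b ∷ l , s)
  raise : Q N (suc k) (b , l , s) → Q (suc N) k (suc b , l , s)

-- V writes a suffix with copies of the maximum.  To make the walk unique, these are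
-- written before the level is raised again, so that V₀ holds until the first raise
-- after a put.
mutual
  data V₀ : ℕ → ℕ → State (Maybe ℕ) → Set where
    put₁ : Path N k l → V₀ (suc N) k (N , l , just N ∷ [])
    put  : V N k (b , l , s?) → V₀ (suc N) k (b , l , just b ∷ s?)
    mark : V₀ N k (b , l , s?) → V₀ (suc N) k (b , l , nothing ∷ s?)

  data V : ℕ → ℕ → State (Maybe ℕ) → Set where
    stay  : V₀ N k (b , l , s?) → V N k (b , l , s?)
    raise : V N (suc k) (b , l , s?) → V (suc N) k (suc b , l , s?)

-- Walks up to the last raise, at which the level becomes the maximum and the marks receive their
-- value. Further copies of the maximum in the prefix are pushed by `Final`.
data Base : ℕ → ℕ → State ℕ → Set where
  raise-path : Path N (suc k) l → Base (suc N) k (suc N , l , [])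
  raise-V    : V N (suc k) (b , l , s?) → Base (suc N) k (suc b , l , map (fromMaybe (suc b)) s?)
  raise-Q    : Q N (suc k) (b , l , s) → Base (suc N) k (suc b , l , s)

data Final : ℕ → ℕ → State ℕ → Set where
  start : Final 0 0 (0 , [] , [])
  base  : Base N k (b , l , s) → Final N k (b , l , s)
  push  : Final N k (b , l , s) → Final N (suc k) (b , b ∷ l , s)

-- Shape, weight and height of what a walk writes

Asc-mono : a ≤ b → Asc a l → Asc b l
Asc-mono a≤b []                 = []
Asc-mono a≤b (x≤a ∷⟨ x≤l ⟩ asc) = ≤-trans x≤a a≤b ∷⟨ x≤l ⟩ asc

Suf-mono : b ≤ d → Suf a b s → Suf a d s
Suf-mono b≤d [ a≤b ]     = [ ≤-trans a≤b b≤d ]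
Suf-mono b≤d (x≤b ∷ suf) = ≤-trans x≤b b≤d ∷ suf

Mix-mono : b ≤ d → Mix a b s? → Mix a d s?
Mix-mono b≤d [ a≤b ]     = [ ≤-trans a≤b b≤d ]
Mix-mono b≤d (x≤b ∷ mix) = ≤-trans x≤b b≤d ∷ mix
Mix-mono b≤d (mark mix)  = mark (Mix-mono b≤d mix)

Jump-mono : b ≤ d → Jump a s b l → Jump a s d l
Jump-mono b≤d (jump x≤b x≤l a<x suf asc) = jump (≤-trans x≤b b≤d) x≤l a<x suf asc
Jump-mono b≤d (x≤b ∷⟨ x≤l ⟩ j)           = ≤-trans x≤b b≤d ∷⟨ x≤l ⟩ j

record Sized {A : Set} (N k b : ℕ) (l : List ℕ) (s : List A) : Set where
  constructor sized
  field
    weight : b + length s ≡ N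
    height : length l ≡ b + k

sized-push : ∀ {A} {s : List A} → Sized N k b l s → Sized N (suc k) b (x ∷ l) s
sized-push {k = k} {b} (sized w h) = sized w (trans (cong suc h) (sym (+-suc b k)))

sized-raise : ∀ {A} {s : List A} → Sized N (suc k) b l s → Sized (suc N) k (suc b) l s
sized-raise {k = k} {b} (sized w h) = sized (cong suc w) (trans h (+-suc b k))

sized-put : ∀ {A} {s : List A} {y} → Sized N k b l s → Sized (suc N) k b l (y ∷ s)
sized-put {b = b} {s = s} (sized w h) = sized (trans (+-suc b (length s)) (cong suc w)) h

≤-height : ∀ {A} {s : List A} → Sized N k b l s → b ≤ length l
≤-height {k = k} {b} (sized _ h) = subst (b ≤_) (sym h) (m≤m+n b k)

path-shape : Path N k l → Asc N l × Sized {ℕ} N k N l []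
path-shape start     = [] , sized refl refl
path-shape (push p)  = let asc , size = path-shape p in
  ≤-refl ∷⟨ ≤-height size ⟩ asc , sized-push size
path-shape (raise p) = let asc , size = path-shape p in
  Asc-mono (n≤1+n _) asc , sized-raise size

T-shape : T N k (b , l , s) → ∃[ a ] Asc a l × Suf a b s × Sized N k b l s
T-shape (put₁ p)  = let asc , size = path-shape p in _ , asc , [ ≤-refl ] , sized-put size
T-shape (put t)   = let a , asc , suf , size = T-shape t in a , asc , ≤-refl ∷ suf , sized-put size
T-shape (raise t) = let a , asc , suf , size = T-shape t in
  a , asc , Suf-mono (n≤1+n _) suf , sized-raise size

Suf⇒≤ : Suf a b s → a ≤ b
Suf⇒≤ [ a≤b ]     = a≤b
Suf⇒≤ (x≤b ∷ suf) = ≤-trans (Suf⇒≤ suf) x≤b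

T₁-shape : T₁ N k (b , l , s) → ∃[ a ] a < b × Asc a l × Suf a b s × Sized N k b l s
T₁-shape (put t)   = let a , a<b , asc , suf , size = T₁-shape t in a , a<b , asc , ≤-refl ∷ suf , sized-put size
T₁-shape (raise t) = let a , asc , suf , size = T-shape t in
  a , s≤s (Suf⇒≤ suf) , asc , Suf-mono (n≤1+n _) suf , sized-raise size

Q-shape : Q N k (b , l , s) → ∃[ a ] Jump a s b l × Sized N k b l s
Q-shape (push₁ t) = let a , a<b , asc , suf , size = T₁-shape t in
  a , jump ≤-refl (≤-height size) a<b suf asc , sized-push size
Q-shape (push q)  = let a , j , size = Q-shape q in a , ≤-refl ∷⟨ ≤-height size ⟩ j , sized-push size
Q-shape (raise q) = let a , j , size = Q-shape q in a , Jump-mono (n≤1+n _) j , sized-raise size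

mutual
  V₀-shape : V₀ N k (b , l , s?) → ∃[ a ] Asc a l × Mix a b s? × Sized N k b l s?
  V₀-shape (put₁ p) = let asc , sized w h = path-shape p in _ , asc , [ ≤-refl ] , sized-put (sized w h)
  V₀-shape (put v)  = let a , asc , mix , size = V-shape v in a , asc , ≤-refl ∷ mix , sized-put size
  V₀-shape (mark v) = let a , asc , mix , size = V₀-shape v in a , asc , mark mix , sized-put size

  V-shape : V N k (b , l , s?) → ∃[ a ] Asc a l × Mix a b s? × Sized N k b l s?
  V-shape (stay v)  = V₀-shape v
  V-shape (raise v) = let a , asc , mix , size = V-shape v in
    a , asc , Mix-mono (n≤1+n _) mix , sized-raise size


-- Reconstruction of a walk from its output

unsized-push : ∀ {A} {s : List A} → b ≤ length l → Sized N k b (x ∷ l) s → ∃[ k′ ] k ≡ suc k′ × Sized N k′ b l s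
-- At height 0 the list `x ∷ l` has only `b` entries, one too few for `b ≤ length l`.
unsized-push {b} {k = zero}  b≤l (sized w h) = ⊥-elim (<⇒≱ (≤-reflexive (trans h (+-identityʳ b))) b≤l)
unsized-push {b} {k = suc k} b≤l (sized w h) = k , refl , sized w (suc-injective (trans h (+-suc b k)))

unsized-raise : ∀ {A} {s : List A} → Sized N k (suc b) l s → ∃[ N′ ] N ≡ suc N′ × Sized N′ (suc k) b l s
unsized-raise {k = k} {b} (sized w h) = _ , sym w , sized refl (trans h (sym (+-suc b k)))

unsized-put : ∀ {A} {s : List A} {y} → Sized N k b l (y ∷ s) → ∃[ N′ ] N ≡ suc N′ × Sized N′ k b l s
unsized-put {b = b} {s = s} (sized w h) = _ , trans (sym w) (+-suc b (length s)) , sized refl h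

-- The last step is forced: a raise if the head of `l` is below the level, a push if it equals the
-- level. Marks aside, the later reconstructions decide in the same way.
path-build : ∀ b l {k} → Asc b l → length l ≡ b + k → Path b k l
path-build zero    []      {zero} []  refl = start
path-build b       (x ∷ l) (x≤b ∷⟨ x≤l ⟩ asc) h with m≤n⇒m<n∨m≡n x≤b
path-build (suc b) (x ∷ l) (_ ∷⟨ x≤l ⟩ asc) h | inj₁ (s≤s x≤b) =
  raise (path-build b (x ∷ l) (x≤b ∷⟨ x≤l ⟩ asc) (trans h (sym (+-suc b _))))
path-build b       (x ∷ l) (_ ∷⟨ x≤l ⟩ asc) h | inj₂ refl
  with unsized-push {l = l} {x = x} {s = [] {A = ℕ}} x≤l (sized refl h)
... | _ , refl , sized _ h′ = push (path-build b l asc h′)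

path-build′ : ∀ {A} → Asc b l → Sized {A} N k b l [] → N ≡ b × Path b k l
path-build′ {b} asc (sized w h) = trans (sym w) (+-identityʳ b) , path-build b _ asc h

T-build : ∀ b s → Suf a b s → Asc a l → Sized N k b l s → T N k (b , l , s)
T-build b       (x ∷ [])    [ x≤b ]     asc size with m≤n⇒m<n∨m≡n x≤b
T-build (suc b) (x ∷ [])    _           asc size | inj₁ (s≤s x≤b) with unsized-raise size
... | _ , refl , size′ = raise (T-build b (x ∷ []) [ x≤b ] asc size′)
T-build b       (x ∷ [])    _           asc size | inj₂ refl with unsized-put size
... | _ , refl , size′ with path-build′ asc size′
... | refl , p = put₁ p
T-build b       (x ∷ s)     (x≤b ∷ suf) asc size with m≤n⇒m<n∨m≡n x≤b
T-build (suc b) (x ∷ s)     (_ ∷ suf)   asc size | inj₁ (s≤s x≤b) with unsized-raise size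
... | _ , refl , size′ = raise (T-build b (x ∷ s) (x≤b ∷ suf) asc size′)
T-build b       (x ∷ s)     (_ ∷ suf)   asc size | inj₂ refl with unsized-put size
... | _ , refl , size′ = put (T-build b s suf asc size′)

T₁-build : ∀ b s → a < b → Suf a b s → Asc a l → Sized N k b l s → T₁ N k (b , l , s)
-- A suffix with one entry consists of `a`, so `a < b` makes the last step a raise.
T₁-build (suc b) (x ∷ []) (s≤s x≤b) [ _ ] asc size with unsized-raise size
... | _ , refl , size′ = raise (T-build b (x ∷ []) [ x≤b ] asc size′)
T₁-build b       (x ∷ s) a<b (x≤b ∷ suf) asc size with m≤n⇒m<n∨m≡n x≤b
T₁-build (suc b) (x ∷ s) a<b (_ ∷ suf)   asc size | inj₁ (s≤s x≤b) with unsized-raise size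
... | _ , refl , size′ = raise (T-build b (x ∷ s) (x≤b ∷ suf) asc size′)
T₁-build b       (x ∷ s) a<b (_ ∷ suf)   asc size | inj₂ refl with unsized-put size
... | _ , refl , size′ = put (T₁-build b s a<b suf asc size′)

Q-build : ∀ b l → Jump a s b l → Sized N k b l s → Q N k (b , l , s)
Q-build b       (x ∷ l) (jump x≤b x≤l a<x suf asc) size with m≤n⇒m<n∨m≡n x≤b
Q-build (suc b) (x ∷ l) (jump _ x≤l a<x suf asc)   size | inj₁ (s≤s x≤b) with unsized-raise size
... | _ , refl , size′ = raise (Q-build b (x ∷ l) (jump x≤b x≤l a<x suf asc) size′)
Q-build b       (x ∷ l) (jump _ x≤l a<x suf asc)   size | inj₂ refl with unsized-push x≤l size
... | _ , refl , size′ = push₁ (T₁-build b _ a<x suf asc size′)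
Q-build b       (x ∷ l) (x≤b ∷⟨ x≤l ⟩ j) size with m≤n⇒m<n∨m≡n x≤b
Q-build (suc b) (x ∷ l) (_ ∷⟨ x≤l ⟩ j)   size | inj₁ (s≤s x≤b) with unsized-raise size
... | _ , refl , size′ = raise (Q-build b (x ∷ l) (x≤b ∷⟨ x≤l ⟩ j) size′)
Q-build b       (x ∷ l) (_ ∷⟨ x≤l ⟩ j)   size | inj₂ refl with unsized-push x≤l size
... | _ , refl , size′ = push (Q-build b l j size′)

-- A mark moves back past the raises to the entry written last, its place in the canonical walk.
V-mark : V N k (b , l , s?) → V (suc N) k (b , l , nothing ∷ s?)
V-mark (stay v)  = stay (mark v)
V-mark (raise v) = raise (V-mark v)

V-build : ∀ b s? → Mix a b s? → Asc a l → Sized N k b l s? → V N k (b , l , s?)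
V-build b       (just x ∷ []) [ x≤b ]     asc size with m≤n⇒m<n∨m≡n x≤b
V-build (suc b) (just x ∷ []) _           asc size | inj₁ (s≤s x≤b) with unsized-raise size
... | _ , refl , size′ = raise (V-build b (just x ∷ []) [ x≤b ] asc size′)
V-build b       (just x ∷ []) _           asc size | inj₂ refl with unsized-put size
... | _ , refl , size′ with path-build′ asc size′
... | refl , p = stay (put₁ p)
V-build b       (just x ∷ s?) (x≤b ∷ mix) asc size with m≤n⇒m<n∨m≡n x≤b
V-build (suc b) (just x ∷ s?) (_ ∷ mix)   asc size | inj₁ (s≤s x≤b) with unsized-raise size
... | _ , refl , size′ = raise (V-build b (just x ∷ s?) (x≤b ∷ mix) asc size′)
V-build b       (just x ∷ s?) (_ ∷ mix)   asc size | inj₂ refl with unsized-put size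
... | _ , refl , size′ = stay (put (V-build b s? mix asc size′))
V-build b       (nothing ∷ s?) (mark mix) asc size with unsized-put size
... | _ , refl , size′ = V-mark (V-build b s? mix asc size′)

-- Telling walks apart by their outputs

Asc-head : Asc b (x ∷ l) → x ≤ b
Asc-head (x≤b ∷⟨ _ ⟩ _) = x≤b

Suf-head : Suf a b (x ∷ s) → x ≤ b
Suf-head [ a≤b ]   = a≤b
Suf-head (x≤b ∷ _) = x≤b

Jump⇒< : Jump a s b l → a < b
Jump⇒< (jump x≤b _ a<x _ _) = ≤-trans a<x x≤b
Jump⇒< (x≤b ∷⟨ _ ⟩ j)       = ≤-trans (Jump⇒< j) x≤b

Jump-head : Jump a s b (x ∷ l) → x ≤ b
Jump-head (jump x≤b _ _ _ _) = x≤b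
Jump-head (x≤b ∷⟨ _ ⟩ _)     = x≤b

-- Keeps only the first entry `a` of the suffix. Walks of different kinds with the same suffix thus
-- share `a`, and their prefixes can be compared with it.
data Ends (a : ℕ) : List ℕ → Set where
  [-] : Ends a (a ∷ [])
  _∷_ : ∀ x → Ends a s → Ends a (x ∷ s)

Ends-unique : Ends a s → Ends b s → a ≡ b
Ends-unique [-]     [-]     = refl
Ends-unique (_ ∷ e) (_ ∷ f) = Ends-unique e f

Suf⇒Ends : Suf a b s → Ends a s
Suf⇒Ends [ _ ]     = [-]
Suf⇒Ends (_ ∷ suf) = _ ∷ Suf⇒Ends suf

Mix⇒Ends : ∀ m → Mix a b s? → Ends a (map (fromMaybe m) s?)
Mix⇒Ends m [ _ ]      = [-]
Mix⇒Ends m (_ ∷ mix)  = _ ∷ Mix⇒Ends m mix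
Mix⇒Ends m (mark mix) = m ∷ Mix⇒Ends m mix

Jump⇒Ends : Jump a s b l → Ends a s
Jump⇒Ends (jump _ _ _ suf _) = Suf⇒Ends suf
Jump⇒Ends (_ ∷⟨ _ ⟩ j)       = Jump⇒Ends j

-- The jump and everything pushed after it lie above `a`. This separates `Q` from `T₁` and `V`.
Jump-¬Asc : Jump a s b l → Asc a l → ⊥
Jump-¬Asc (jump _ _ a<x _ _) asc = <⇒≱ a<x (Asc-head asc)
Jump-¬Asc (_ ∷⟨ _ ⟩ j)       asc = <⇒≱ (Jump⇒< j) (Asc-head asc)

path-¬< : Path N k (x ∷ l) → ¬ N < x
path-¬< p N<x = <⇒≱ N<x (Asc-head (proj₁ (path-shape p)))

T-¬< : T N k (b , l , x ∷ s) → ¬ b < x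
T-¬< t b<x = let _ , _ , suf , _ = T-shape t in <⇒≱ b<x (Suf-head suf)

Q-¬< : Q N k (b , x ∷ l , s) → ¬ b < x
Q-¬< q b<x = let _ , j , _ = Q-shape q in <⇒≱ b<x (Jump-head j)

T₁-¬Q : T₁ N k (b , l , s) → Q N m (d , l , s) → ⊥
T₁-¬Q t q with T₁-shape t | Q-shape q
... | _ , _ , asc , suf , _ | _ , j , _ with Ends-unique (Suf⇒Ends suf) (Jump⇒Ends j)
... | refl = Jump-¬Asc j asc

V-¬Q : V N k (b , l , s?) → Q N m (d , l , map (fromMaybe x) s?) → ⊥
V-¬Q {x = x} v q with V-shape v | Q-shape q
... | _ , asc , mix , _ | _ , j , _ with Ends-unique (Mix⇒Ends x mix) (Jump⇒Ends j)
... | refl = Jump-¬Asc j asc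

mutual
  -- Marks aside, the last entry of a `V₀` walk equals its level `suc b`, too large for a suffix
  -- written up to level `b`. Hence `stay` and `raise` never give the same state.
  V₀-¬V : V₀ N k (suc b , l , s?) → V m d (b , l , s?) → ⊥
  V₀-¬V v₀ v = let _ , _ , mix , _ = V-shape v in V₀-¬Mix v₀ mix

  V₀-¬Mix : V₀ N k (suc b , l , s?) → Mix a b s? → ⊥
  V₀-¬Mix (put₁ _) [ b<b ]    = 1+n≰n b<b
  V₀-¬Mix (put₁ _) (_ ∷ ())
  V₀-¬Mix (put _)  [ b<b ]    = 1+n≰n b<b
  V₀-¬Mix (put _)  (b<b ∷ _)  = 1+n≰n b<b
  V₀-¬Mix (mark v) (mark mix) = V₀-¬Mix v mix

-- Counting walks by their last step

pushₛ raiseₛ : {A : Set} → State A → State A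
pushₛ  (b , l , s) = b , b ∷ l , s
raiseₛ (b , l , s) = suc b , l , s

putₛ : {A : Set} → (ℕ → A) → State A → State A
putₛ f (b , l , s) = b , l , f b ∷ s

pushₛ-injective : ∀ {A} {x y : State A} → pushₛ x ≡ pushₛ y → x ≡ y
pushₛ-injective refl = refl

raiseₛ-injective : ∀ {A} {x y : State A} → raiseₛ x ≡ raiseₛ y → x ≡ y
raiseₛ-injective refl = refl

putₛ-injective : ∀ {A} (f : ℕ → A) {x y : State A} → putₛ f x ≡ putₛ f y → x ≡ y
putₛ-injective f e = cong₂ _,_ (cong proj₁ e) (cong₂ _,_ (cong (proj₁ ∘ proj₂) e) (∷-injectiveʳ (cong (proj₂ ∘ proj₂) e)))

count-path : ∀ N k → Counted (Path N k) (cat N (suc k))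
count-path zero zero = counted-≐ (λ { refl → start }) (λ { start → refl }) (counted-≡ [])
count-path zero (suc k) = counted-≐
  (λ { (_ , p , refl) → push p })
  (λ { (push p) → _ , p , refl })
  (counted-image (0 ∷_) (λ _ _ → ∷-injectiveʳ) (count-path zero k))
count-path (suc N) zero = counted-≐ raise (λ { (raise p) → p }) (count-path N 1)
count-path (suc N) (suc k) = counted-≐
  (λ { (inj₁ (_ , p , refl)) → push p ; (inj₂ p) → raise p })
  (λ { (push p) → inj₁ (_ , p , refl) ; (raise p) → inj₂ p })
  (counted-⊎ (counted-image (suc N ∷_) (λ _ _ → ∷-injectiveʳ) (count-path (suc N) k)) (count-path N (2 + k))
    (λ { (_ , _ , refl) p → path-¬< p (n<1+n N) }))

T-nonempty : ¬ T N k (b , l , [])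
T-nonempty t with T-shape t
... | _ , _ , () , _

Q-nonempty : ¬ Q N k (b , l , [])
Q-nonempty q with Jump⇒Ends (proj₁ (proj₂ (Q-shape q)))
... | ()

V-nonempty : ¬ V N k (b , l , [])
V-nonempty v with V-shape v
... | _ , _ , () , _

count-T : ∀ N k → Counted (T N k) (#T N k)
count-T zero    k = counted-∅ (λ _ ())
count-T (suc N) k = subst (Counted _) (#T-suc N k) (counted-≐
  (λ { (inj₁ (_ , p , refl)) → put₁ p
     ; (inj₂ (inj₁ (_ , t , refl))) → put t
     ; (inj₂ (inj₂ (_ , t , refl))) → raise t })
  (λ { (put₁ p) → inj₁ (_ , p , refl)
     ; (put t) → inj₂ (inj₁ (_ , t , refl))
     ; (raise t) → inj₂ (inj₂ (_ , t , refl)) })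
  (counted-⊎
    (counted-image (λ l → N , l , N ∷ []) (λ { _ _ refl → refl }) (count-path N k))
    (counted-⊎
      (counted-image (putₛ id) (λ _ _ → putₛ-injective id) (count-T N k))
      (counted-image raiseₛ (λ _ _ → raiseₛ-injective) (count-T N (suc k)))
      (λ { (_ , _ , refl) (_ , t , refl) → T-¬< t (n<1+n _) }))
    (λ { (_ , _ , refl) (inj₁ (_ , t , refl)) → T-nonempty t
       ; (_ , _ , refl) (inj₂ (_ , t , refl)) → T-¬< t (n<1+n _) })))

count-T₁ : ∀ N k → Counted (T₁ N k) (#T₁ N k)
count-T₁ zero    k = counted-∅ (λ _ ())
count-T₁ (suc N) k = subst (Counted _) (#T₁-suc N k) (counted-≐
  (λ { (inj₁ (_ , t , refl)) → raise t ; (inj₂ (_ , t , refl)) → put t })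
  (λ { (raise t) → inj₁ (_ , t , refl) ; (put t) → inj₂ (_ , t , refl) })
  (counted-⊎
    (counted-image raiseₛ (λ _ _ → raiseₛ-injective) (count-T N (suc k)))
    (counted-image (putₛ id) (λ _ _ → putₛ-injective id) (count-T₁ N k))
    (λ { (_ , t , refl) (_ , _ , refl) → T-¬< t (n<1+n _) })))

Q-nonzero : ∀ {σ} → ¬ Q 0 k σ
Q-nonzero (push q) = Q-nonzero q

count-Q : ∀ N k → Counted (Q N k) (#Q N k)
count-Q zero    k = counted-∅ (λ _ → Q-nonzero)
count-Q (suc N) zero = subst (Counted _) (#Q-zero N) (counted-≐
  (λ { (_ , q , refl) → raise q })
  (λ { (raise q) → _ , q , refl })
  (counted-image raiseₛ (λ _ _ → raiseₛ-injective) (count-Q N 1)))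
count-Q (suc N) (suc k) = subst (Counted _) (#Q-suc N k) (counted-≐
  (λ { (inj₁ (_ , q , refl)) → push q
     ; (inj₂ (inj₁ (_ , t , refl))) → push₁ t
     ; (inj₂ (inj₂ (_ , q , refl))) → raise q })
  (λ { (push q) → inj₁ (_ , q , refl)
     ; (push₁ t) → inj₂ (inj₁ (_ , t , refl))
     ; (raise q) → inj₂ (inj₂ (_ , q , refl)) })
  (counted-⊎
    (counted-image pushₛ (λ _ _ → pushₛ-injective) (count-Q (suc N) k))
    (counted-⊎
      (counted-image pushₛ (λ _ _ → pushₛ-injective) (count-T₁ (suc N) k))
      (counted-image raiseₛ (λ _ _ → raiseₛ-injective) (count-Q N (2 + k)))
      (λ { (_ , _ , refl) (_ , q , refl) → Q-¬< q (n<1+n _) }))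
    (λ { (_ , q , refl) (inj₁ (_ , t , refl)) → T₁-¬Q t q
       ; (_ , _ , refl) (inj₂ (_ , q , refl)) → Q-¬< q (n<1+n _) })))

mutual
  -- The numbers are those of `T`, with the roles changed: `mark` takes the place of `put`, and
  -- `put`, applied to a `V` of the same height, that of `raise`.
  count-V₀ : ∀ N k → Counted (V₀ N k) (#T N k)
  count-V₀ zero    k = counted-∅ (λ _ ())
  count-V₀ (suc N) k = subst (Counted _) (#T-suc N k) (counted-≐
    (λ { (inj₁ (_ , p , refl)) → put₁ p
       ; (inj₂ (inj₁ (_ , v , refl))) → mark v
       ; (inj₂ (inj₂ (_ , v , refl))) → put v })
    (λ { (put₁ p) → inj₁ (_ , p , refl)
       ; (mark v) → inj₂ (inj₁ (_ , v , refl))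
       ; (put v) → inj₂ (inj₂ (_ , v , refl)) })
    (counted-⊎
      (counted-image (λ l → N , l , just N ∷ []) (λ { _ _ refl → refl }) (count-path N k))
      (counted-⊎
        (counted-image (putₛ (λ _ → nothing)) (λ _ _ → putₛ-injective (λ _ → nothing)) (count-V₀ N k))
        (counted-image (putₛ just) (λ _ _ → putₛ-injective just) (count-V N k))
        (λ { (_ , _ , refl) (_ , _ , ()) }))
      (λ { (_ , _ , refl) (inj₁ (_ , _ , ()))
         ; (_ , _ , refl) (inj₂ (_ , v , refl)) → V-nonempty v })))

  count-V : ∀ N k → Counted (V N k) (#T N (suc k))
  count-V zero    k = counted-∅ (λ { _ (stay ()) })
  count-V (suc N) k = subst (Counted _) (#T-suc′ N k) (counted-≐
    (λ { (inj₁ v) → stay v ; (inj₂ (_ , v , refl)) → raise v })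
    (λ { (stay v) → inj₁ v ; (raise v) → inj₂ (_ , v , refl) })
    (counted-⊎
      (count-V₀ (suc N) k)
      (counted-image raiseₛ (λ _ _ → raiseₛ-injective) (count-V N (suc k)))
      (λ { v₀ (_ , v , refl) → V₀-¬V v₀ v })))

finishₛ : State (Maybe ℕ) → State ℕ
finishₛ (b , l , s?) = suc b , l , map (fromMaybe (suc b)) s?

Bounded : ℕ → Maybe ℕ → Set
Bounded b nothing  = ⊤
Bounded b (just x) = x ≤ b

Mix⇒≤ : Mix a b s? → a ≤ b
Mix⇒≤ [ a≤b ]     = a≤b
Mix⇒≤ (x≤b ∷ mix) = ≤-trans (Mix⇒≤ mix) x≤b
Mix⇒≤ (mark mix)  = Mix⇒≤ mix

Mix-bounded : d ≤ b → Mix a d s? → All (Bounded b) s?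
Mix-bounded d≤b [ a≤d ]     = ≤-trans a≤d d≤b ∷ []
Mix-bounded d≤b (x≤d ∷ mix) = ≤-trans x≤d d≤b ∷ Mix-bounded (≤-trans x≤d d≤b) mix
Mix-bounded d≤b (mark mix)  = _ ∷ Mix-bounded d≤b mix

-- A mark decodes to `suc b`, which exceeds every bounded entry.
decode-injective : ∀ {s t} → All (Bounded b) s → All (Bounded b) t →
                   map (fromMaybe (suc b)) s ≡ map (fromMaybe (suc b)) t → s ≡ t
decode-injective {s = []}    {[]}    _ _ _ = refl
decode-injective {s = x ∷ s} {y ∷ t} (x≤b ∷ s≤b) (y≤b ∷ t≤b) e =
  cong₂ _∷_ (entry x y x≤b y≤b (∷-injectiveˡ e)) (decode-injective s≤b t≤b (∷-injectiveʳ e))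
  where
  entry : ∀ x y → Bounded b x → Bounded b y → fromMaybe (suc b) x ≡ fromMaybe (suc b) y → x ≡ y
  entry nothing  nothing  _   _   _    = refl
  entry nothing  (just _) _   y≤b refl = ⊥-elim (1+n≰n y≤b)
  entry (just _) nothing  x≤b _   refl = ⊥-elim (1+n≰n x≤b)
  entry (just _) (just _) _   _   e    = cong just e

V-bounded : V N k (b , l , s?) → All (Bounded b) s?
V-bounded v = let _ , _ , mix , _ = V-shape v in Mix-bounded ≤-refl mix

finishₛ-injective : ∀ {x y} → V N k x → V N k y → finishₛ x ≡ finishₛ y → x ≡ y
finishₛ-injective {x = b , l , s} {y = _ , _ , t} v w e with cong proj₁ e | cong (proj₁ ∘ proj₂) e
... | refl | refl = cong (λ z → b , l , z)
  (decode-injective (V-bounded v) (V-bounded w) (cong (proj₂ ∘ proj₂) e))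

path-V-disjoint : ∀ {σ} → V N k σ → (b , l , []) ≢ finishₛ σ
path-V-disjoint {σ = _ , _ , []}    v e  = V-nonempty v
path-V-disjoint {σ = _ , _ , _ ∷ _} v ()

V-Q-disjoint : ∀ {σ τ} → V N k σ → Q N k τ → finishₛ σ ≢ raiseₛ τ
V-Q-disjoint v q refl = V-¬Q v q

count-base : ∀ N k → Counted (Base (suc N) k) (cat N (2 + k) + (#T N (2 + k) + #Q N (suc k)))
count-base N k = counted-≐
  (λ { (inj₁ (_ , p , refl)) → raise-path p
     ; (inj₂ (inj₁ (_ , v , refl))) → raise-V v
     ; (inj₂ (inj₂ (_ , q , refl))) → raise-Q q })
  (λ { (raise-path p) → inj₁ (_ , p , refl)
     ; (raise-V v) → inj₂ (inj₁ (_ , v , refl))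
     ; (raise-Q q) → inj₂ (inj₂ (_ , q , refl)) })
  (counted-⊎
    (counted-image (λ l → suc N , l , []) (λ { _ _ refl → refl }) (count-path N (suc k)))
    (counted-⊎
      (counted-image finishₛ finishₛ-injective (count-V N (suc k)))
      (counted-image raiseₛ (λ _ _ → raiseₛ-injective) (count-Q N (suc k)))
      (λ { (_ , v , refl) (_ , q , e) → V-Q-disjoint v q e }))
    (λ { (_ , _ , refl) (inj₁ (_ , v , e)) → path-V-disjoint v e
       ; (_ , _ , refl) (inj₂ (_ , q , refl)) → Q-nonempty q }))

-- The final raise leaves the level strictly above all of `l`.
Base-¬push : ¬ Base N k (b , b ∷ l , s)
Base-¬push (raise-path p) = path-¬< p (n<1+n _)
Base-¬push (raise-Q q) = Q-¬< q (n<1+n _)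
Base-¬push (raise-V v) = let _ , asc , mix , _ = V-shape v in <⇒≱ (s≤s (Mix⇒≤ mix)) (Asc-head asc)

count-final : ∀ N t → Counted (Final N t) (#final N t)
count-final zero    zero    = counted-≐ (λ { refl → start }) (λ { start → refl }) (counted-≡ (0 , [] , []))
count-final zero    (suc t) = counted-≐
  (λ { (_ , f , refl) → push f })
  (λ { (push f) → _ , f , refl })
  (counted-image pushₛ (λ _ _ → pushₛ-injective) (count-final zero t))
count-final (suc N) zero    = counted-≐ base (λ { (base b) → b }) (count-base N 0)
count-final (suc N) (suc t) = counted-≐
  (λ { (inj₁ (_ , f , refl)) → push f ; (inj₂ b) → base b })
  (λ { (push f) → inj₁ (_ , f , refl) ; (base b) → inj₂ b })
  (counted-⊎ (counted-image pushₛ (λ _ _ → pushₛ-injective) (count-final (suc N) t)) (count-base N (suc t))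
    (λ { (_ , _ , refl) b → Base-¬push b }))

-- Walks and pattern avoidance

NoneBetween : List ℕ → ℕ → ℕ → Set
NoneBetween l x y = All (λ z → ¬ (y < z × z < x)) l

-- For an entry y of s occurring before an entry x: the two clauses exclude 210
-- with first entry b and 102 with first entry in l.
Compatible : ℕ → List ℕ → ℕ → ℕ → Set
Compatible b l x y = (y ≤ x ⊎ y ≡ b) × NoneBetween l x y

-- Mediates between walks and patterns. Together with `b ≤ length l`, which comes from the height,
-- these conditions characterise the avoiding inversion sequences cut at their first descent.
record Shape (b : ℕ) (l s : List ℕ) : Set where
  field
    ascending : Asc b l
    bounded   : All (_≤ b) s
    pairs     : AllPairs (Compatible b l) s
    descent   : s ≡ [] ⊎ ∃[ a ] Ends a s × a < b

AllPairs-zipAll : ∀ {P : ℕ → Set} {R S : ℕ → ℕ → Set} → (∀ {x y} → P x → P y → R x y → S x y) →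
                  All P s → AllPairs R s → AllPairs S s
AllPairs-zipAll f []         []           = []
AllPairs-zipAll f (px ∷ pxs) (rx ∷ rxs) =
  All.zipWith (λ (py , r) → f px py r) (pxs , rx) ∷ AllPairs-zipAll f pxs rxs

-- No entry of the suffix exceeds `b`, so `b` is never strictly between two of them.
NoneBetween-push : ∀ {R : ℕ → ℕ → Set} → All (_≤ b) s →
  AllPairs (λ x y → R x y × NoneBetween l x y) s → AllPairs (λ x y → R x y × NoneBetween (b ∷ l) x y) s
NoneBetween-push = AllPairs-zipAll (λ x≤b _ (r , none) → r , (λ (_ , b<x) → <⇒≱ b<x x≤b) ∷ none)

Asc⇒All : Asc b l → All (_≤ b) l
Asc⇒All []               = []
Asc⇒All (x≤b ∷⟨ _ ⟩ asc) = x≤b ∷ All.map (λ y≤x → ≤-trans y≤x x≤b) (Asc⇒All asc)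

≤⇒NoneBetween : ∀ {y} → a ≤ y → Asc a l → NoneBetween l x y
≤⇒NoneBetween a≤y asc = All.map (λ z≤a (y<z , _) → <⇒≱ y<z (≤-trans z≤a a≤y)) (Asc⇒All asc)

Suf⇒All : Suf a b s → All (λ y → a ≤ y × y ≤ b) s
Suf⇒All [ a≤b ]     = (≤-refl , a≤b) ∷ []
Suf⇒All (x≤b ∷ suf) = (Suf⇒≤ suf , x≤b) ∷ All.map (λ (a≤y , y≤x) → a≤y , ≤-trans y≤x x≤b) (Suf⇒All suf)

Suf⇒pairs : Suf a b s → Asc a l → AllPairs (λ x y → y ≤ x × NoneBetween l x y) s
Suf⇒pairs [ _ ]     asc = [] ∷ []
Suf⇒pairs (_ ∷ suf) asc = All.map (λ (a≤y , y≤x) → y≤x , ≤⇒NoneBetween a≤y asc) (Suf⇒All suf) ∷ Suf⇒pairs suf asc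

Jump⇒Asc : Jump a s b l → Asc b l
Jump⇒Asc (jump x≤b x≤l a<x _ asc) = x≤b ∷⟨ x≤l ⟩ Asc-mono (<⇒≤ a<x) asc
Jump⇒Asc (x≤b ∷⟨ x≤l ⟩ j)         = x≤b ∷⟨ x≤l ⟩ Jump⇒Asc j

Jump⇒pairs : Jump a s b l → All (_≤ b) s × AllPairs (λ x y → y ≤ x × NoneBetween l x y) s
Jump⇒pairs (jump x≤b x≤l a<x suf asc) =
  All.map (λ (_ , y≤x) → ≤-trans y≤x x≤b) (Suf⇒All suf) ,
  NoneBetween-push (All.map proj₂ (Suf⇒All suf)) (Suf⇒pairs suf asc)
Jump⇒pairs (x≤b ∷⟨ _ ⟩ j) = let bounded , pairs = Jump⇒pairs j in
  All.map (λ y≤x → ≤-trans y≤x x≤b) bounded , NoneBetween-push bounded pairs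

Mix⇒All : ∀ m → a ≤ m → Mix a b s? → All (λ y → a ≤ y × (y ≤ b ⊎ y ≡ m)) (map (fromMaybe m) s?)
Mix⇒All m a≤m [ a≤b ]     = (≤-refl , inj₁ a≤b) ∷ []
Mix⇒All m a≤m (x≤b ∷ mix) = (Mix⇒≤ mix , inj₁ x≤b) ∷
  All.map (λ { (a≤y , inj₁ y≤x) → a≤y , inj₁ (≤-trans y≤x x≤b) ; (a≤y , inj₂ y≡m) → a≤y , inj₂ y≡m })
    (Mix⇒All m a≤m mix)
Mix⇒All m a≤m (mark mix)  = (a≤m , inj₂ refl) ∷ Mix⇒All m a≤m mix

Mix⇒pairs : ∀ m → b ≤ m → Mix a b s? → Asc a l → AllPairs (Compatible m l) (map (fromMaybe m) s?)
Mix⇒pairs m b≤m [ _ ]       asc = [] ∷ []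
Mix⇒pairs m b≤m (x≤b ∷ mix) asc =
  All.map (λ (a≤y , y≤x) → y≤x , ≤⇒NoneBetween a≤y asc) (Mix⇒All m (≤-trans (Mix⇒≤ mix) x≤m) mix)
  ∷ Mix⇒pairs m x≤m mix asc
  where x≤m = ≤-trans x≤b b≤m
Mix⇒pairs m b≤m (mark mix)  asc =
  All.map (λ (a≤y , y≤) → inj₁ ([ (λ y≤b → ≤-trans y≤b b≤m) , ≤-reflexive ]′ y≤) , ≤⇒NoneBetween a≤y asc)
    (Mix⇒All m (≤-trans (Mix⇒≤ mix) b≤m) mix)
  ∷ Mix⇒pairs m b≤m mix asc

base-shape : Base N k (b , l , s) → Shape b l s × Sized N k b l s
base-shape (raise-path p) = let asc , size = path-shape p in
  record { ascending = Asc-mono (n≤1+n _) asc ; bounded = [] ; pairs = [] ; descent = inj₁ refl } , sized-raise size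
base-shape (raise-Q q) = let a , j , size = Q-shape q ; bounded , pairs = Jump⇒pairs j in
  record
  { ascending = Asc-mono (n≤1+n _) (Jump⇒Asc j)
  ; bounded   = All.map m≤n⇒m≤1+n bounded
  ; pairs     = AllPairs.map (λ (y≤x , none) → inj₁ y≤x , none) pairs
  ; descent   = inj₂ (a , Jump⇒Ends j , s≤s (<⇒≤ (Jump⇒< j)))
  } , sized-raise size
base-shape (raise-V {b = b} {s? = s?} v) with V-shape v
... | a , asc , mix , sized w h = record
  { ascending = Asc-mono (m≤n⇒m≤1+n (Mix⇒≤ mix)) asc
  ; bounded   = All.map (λ (_ , y≤) → [ m≤n⇒m≤1+n , ≤-reflexive ]′ y≤) (Mix⇒All (suc b) (m≤n⇒m≤1+n (Mix⇒≤ mix)) mix)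
  ; pairs     = Mix⇒pairs (suc b) (n≤1+n b) mix asc
  ; descent   = inj₂ (a , Mix⇒Ends (suc b) mix , s≤s (Mix⇒≤ mix))
  } , sized-raise (sized (trans (cong (_+_ b) (length-map (fromMaybe (suc b)) s?)) w) h)

final-shape : Final N k (b , l , s) → Shape b l s × Sized N k b l s
final-shape start = record { ascending = [] ; bounded = [] ; pairs = [] ; descent = inj₁ refl } , sized refl refl
final-shape (base β) = base-shape β
final-shape (push f) with final-shape f
... | shape , size = record
  { ascending = ≤-refl ∷⟨ ≤-height size ⟩ ascending
  ; bounded   = bounded
  ; pairs     = NoneBetween-push bounded pairs
  ; descent   = descent
  } , sized-push size
  where open Shape shape

-- From the pattern conditions to a walk

Ends⇒All : ∀ {P : ℕ → Set} {R : ℕ → ℕ → Set} → P a → (∀ {x} → R x a → P x) → Ends a s → AllPairs R s → All P s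
Ends⇒All pa f [-]      _          = pa ∷ []
Ends⇒All pa f (x ∷ e) (rx ∷ rxs) = f (last e rx) ∷ Ends⇒All pa f e rxs
  where
  last : ∀ {s} {P : ℕ → Set} → Ends a s → All P s → P a
  last [-]     (pa ∷ []) = pa
  last (_ ∷ e) (_ ∷ ps)  = last e ps

Suf-build : Ends a s → All (_≤ b) s → AllPairs (λ x y → y ≤ x) s → Suf a b s
Suf-build [-]     (a≤b ∷ []) _          = [ a≤b ]
Suf-build (_ ∷ e) (x≤b ∷ _)  (≤x ∷ desc) = x≤b ∷ Suf-build e ≤x desc

-- An entry above `x` after `a < x` would complete a 102 with `x`. Hence the suffix is bounded by
-- `x < m`, contains no copy of `m`, and is sorted.
Suf-below : x < m → a < x → Ends a s → AllPairs (Compatible m (x ∷ l)) s → Suf a x s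
Suf-below {x} {s = s} x<m a<x e pairs = Suf-build e s≤x
  (AllPairs-zipAll (λ _ y≤x (r , _) → [ id , (λ y≡m → ⊥-elim (<⇒≱ x<m (subst (_≤ x) y≡m y≤x))) ]′ r) s≤x pairs)
  where
  s≤x : All (_≤ x) s
  s≤x = Ends⇒All (<⇒≤ a<x) (λ (_ , none) → ≮⇒≥ (λ x<w → All.head none (a<x , x<w))) e pairs

-- Descends to the earliest entry of the prefix above `a`, which bounds the suffix most tightly.
Jump-build : ∀ x l → x < m → a < x → Asc b (x ∷ l) → Ends a s →
             AllPairs (Compatible m (x ∷ l)) s → Jump a s b (x ∷ l)
Jump-build x []      x<m a<x (x≤b ∷⟨ x≤l ⟩ [])  e pairs = jump x≤b x≤l a<x (Suf-below x<m a<x e pairs) []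
Jump-build {a = a} x (y ∷ l) x<m a<x (x≤b ∷⟨ x≤l ⟩ asc) e pairs with y ≤? a | asc
... | yes y≤a | _ ∷⟨ y≤l ⟩ asc′ = jump x≤b x≤l a<x (Suf-below x<m a<x e pairs) (y≤a ∷⟨ y≤l ⟩ asc′)
... | no y≰a  | y≤x ∷⟨ _ ⟩ _    = x≤b ∷⟨ x≤l ⟩
  Jump-build y l (≤-<-trans y≤x x<m) (≰⇒> y≰a) asc e (AllPairs.map (λ (r , none) → r , All.tail none) pairs)

Mix-build : a < m → Ends a s → All (λ y → y ≤ b ⊎ y ≡ m) s → AllPairs (λ x y → y ≤ x ⊎ y ≡ m) s →
            ∃[ s? ] Mix a b s? × s ≡ map (fromMaybe m) s?
Mix-build a<m [-]     (inj₁ a≤b ∷ [])  _          = _ , [ a≤b ] , refl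
Mix-build a<m [-]     (inj₂ refl ∷ []) _          = ⊥-elim (1+n≰n a<m)
Mix-build a<m (x ∷ e) (inj₁ x≤b ∷ _) (rx ∷ rxs) with Mix-build a<m e rx rxs
... | s? , mix , refl = just x ∷ s? , x≤b ∷ mix , refl
Mix-build a<m (x ∷ e) (inj₂ refl ∷ s≤b) (rx ∷ rxs) with Mix-build a<m e s≤b rxs
... | s? , mix , refl = nothing ∷ s? , mark mix , refl

-- As `l` is sorted, its head decides the kind of the suffix: a head above `a` means a jump, and
-- otherwise copies of the maximum may occur.
base-build : Asc b l → Shape (suc b) l s → Sized N k (suc b) l s → Base N k (suc b , l , s)
base-build asc record { descent = inj₁ refl } size with unsized-raise size
... | _ , refl , size′ with path-build′ asc size′
... | refl , p = raise-path p
base-build {b} {l} asc record { bounded = bounded ; pairs = pairs ; descent = inj₂ (a , e , s≤s a≤b) } size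
  with unsized-raise size | below a≤b l asc
  where
  below : ∀ {a b} → a ≤ b → ∀ l → Asc b l → Asc a l ⊎ (∃[ x ] ∃[ l′ ] l ≡ x ∷ l′ × a < x)
  below a≤b []      _ = inj₁ []
  below {a} a≤b (x ∷ l) (_ ∷⟨ x≤l ⟩ asc) with x ≤? a
  ... | yes x≤a = inj₁ (x≤a ∷⟨ x≤l ⟩ asc)
  ... | no x≰a  = inj₂ (x , l , refl , ≰⇒> x≰a)
... | _ , refl , size′ | inj₂ (x , l′ , refl , a<x) =
  raise-Q (Q-build b l (Jump-build x l′ (s≤s (Asc-head asc)) a<x asc e pairs) size′)
... | _ , refl , sized w h | inj₁ asc′
  with Mix-build (s≤s a≤b) e (All.map (λ y≤ → [ inj₁ ∘ s≤s⁻¹ , inj₂ ]′ (m≤n⇒m<n∨m≡n y≤)) bounded) (AllPairs.map proj₁ pairs)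
... | s? , mix , refl =
  raise-V (V-build b s? mix asc′ (sized (trans (cong (_+_ b) (sym (length-map (fromMaybe (suc b)) s?))) w) h))

final-build : ∀ l → Shape b l s → Sized N k b l s → Final N k (b , l , s)
-- An empty `l` forces `b = 0`, and no suffix can begin below that.
final-build []      shape size with ≤-height size | Shape.descent shape
final-build {k = zero} [] shape (sized refl refl) | z≤n | inj₁ refl = start
final-build (x ∷ l) shape size with Shape.ascending shape
... | x≤b ∷⟨ x≤l ⟩ asc with m≤n⇒m<n∨m≡n x≤b
... | inj₁ (s≤s x≤b′) = base (base-build (x≤b′ ∷⟨ x≤l ⟩ asc) shape size)
... | inj₂ refl with unsized-push x≤l size
...   | _ , refl , size′ = push (final-build l record
  { ascending = asc
  ; bounded   = bounded
  ; pairs     = AllPairs.map (λ (r , none) → r , All.tail none) pairs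
  ; descent   = descent
  } size′)
  where open Shape shape

-- Inversion sequences and their reversed lists of entries

module _ {A : Set} where

  split-⊆ : ∀ {as} (bs {cs} : List A) → as ⊆ bs ++ cs → ∃[ as₁ ] ∃[ as₂ ] as ≡ as₁ ++ as₂ × as₁ ⊆ bs × as₂ ⊆ cs
  split-⊆ []       τ          = [] , _ , refl , [] , τ
  split-⊆ (b ∷ bs) (.b ∷ʳ τ)  = let as₁ , as₂ , e , τ₁ , τ₂ = split-⊆ bs τ in as₁ , as₂ , e , b ∷ʳ τ₁ , τ₂
  split-⊆ (b ∷ bs) (refl ∷ τ) = let as₁ , as₂ , e , τ₁ , τ₂ = split-⊆ bs τ in
    b ∷ as₁ , as₂ , cong (b ∷_) e , refl ∷ τ₁ , τ₂

  AllPairs-lookup : ∀ {R : A → A → Set} {x y xs} → AllPairs R xs → (x ∷ y ∷ []) ⊆ xs → R x y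
  AllPairs-lookup (_ ∷ rxs)  (_ ∷ʳ τ)   = AllPairs-lookup rxs τ
  AllPairs-lookup (rx ∷ _)   (refl ∷ τ) = All.lookup rx (to∈ τ)

  AllPairs-tabulate : ∀ {R : A → A → Set} xs → (∀ {x y} → (x ∷ y ∷ []) ⊆ xs → R x y) → AllPairs R xs
  AllPairs-tabulate []       f = []
  AllPairs-tabulate (x ∷ xs) f = All.tabulate (λ y∈ → f (refl ∷ from∈ y∈)) ∷ AllPairs-tabulate xs (f ∘ (x ∷ʳ_))

  lookup-⊆ : (e : Vec A n) (i : Fin n) → (lookup e i ∷ []) ⊆ toList e
  lookup-⊆ (x ∷ e) zero    = refl ∷ minimum _
  lookup-⊆ (x ∷ e) (suc i) = x ∷ʳ lookup-⊆ e i

  lookup₂-⊆ : (e : Vec A n) {i j : Fin n} → i Fin.< j → (lookup e i ∷ lookup e j ∷ []) ⊆ toList e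
  lookup₂-⊆ (x ∷ e) {zero}  {suc j} _         = refl ∷ lookup-⊆ e j
  lookup₂-⊆ (x ∷ e) {suc i} {suc j} (s≤s i<j) = x ∷ʳ lookup₂-⊆ e i<j

  lookup₃-⊆ : (e : Vec A n) {h i j : Fin n} → h Fin.< i → i Fin.< j →
              (lookup e h ∷ lookup e i ∷ lookup e j ∷ []) ⊆ toList e
  lookup₃-⊆ (x ∷ e) {zero}  {suc i} {suc j} _         (s≤s i<j) = refl ∷ lookup₂-⊆ e i<j
  lookup₃-⊆ (x ∷ e) {suc h} {suc i} {suc j} (s≤s h<i) (s≤s i<j) = x ∷ʳ lookup₃-⊆ e h<i i<j

  ⊆-lookup : (e : Vec A n) {xs : List A} → xs ⊆ toList e → ∃[ js ] AllPairs Fin._<_ js × map (lookup e) js ≡ xs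
  ⊆-lookup []      []         = [] , [] , refl
  ⊆-lookup (x ∷ e) (.x ∷ʳ τ)  = let js , incr , eq = ⊆-lookup e τ in
    map suc js , AllPairs.map⁺ (AllPairs.map s≤s incr) , trans (sym (map-∘ js)) eq
  ⊆-lookup (x ∷ e) (refl ∷ τ) = let js , incr , eq = ⊆-lookup e τ in
    zero ∷ map suc js , All.map⁺ (All.tabulate (λ _ → s≤s z≤n)) ∷ AllPairs.map⁺ (AllPairs.map s≤s incr) , cong (x ∷_) (trans (sym (map-∘ js)) eq)

-- The two patterns in reversed sequences

Triple : ℕ → ℕ → ℕ → Vec ℕ n → Set
Triple x y z e = (z ∷ y ∷ x ∷ []) ⊆ reverse (toList e)

both-≡ : ∀ {p q : ℕ} → (p < p ⇔ q < q) × (p ≡ p ⇔ q ≡ q)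
both-≡ = mk⇔ (⊥-elim ∘ 1+n≰n) (⊥-elim ∘ 1+n≰n) , mk⇔ (λ _ → refl) (λ _ → refl)

both-< : ∀ {p q p′ q′} → p < q → p′ < q′ → (p < q ⇔ p′ < q′) × (p ≡ q ⇔ p′ ≡ q′)
both-< p<q p′<q′ = mk⇔ (λ _ → p′<q′) (λ _ → p<q) , mk⇔ (⊥-elim ∘ <⇒≢ p<q) (⊥-elim ∘ <⇒≢ p′<q′)

both-> : ∀ {p q p′ q′} → q < p → q′ < p′ → (p < q ⇔ p′ < q′) × (p ≡ q ⇔ p′ ≡ q′)
both-> q<p q′<p′ = mk⇔ (⊥-elim ∘ <-asym q<p) (⊥-elim ∘ <-asym q′<p′) ,
  mk⇔ (⊥-elim ∘ >⇒≢ q<p) (⊥-elim ∘ >⇒≢ q′<p′)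

-- Two inequalities determine all nine comparisons of the order isomorphism, the remaining strict
-- one by transitivity.
contains-102 : (e : Vec ℕ n) → Contains e (1 ∷ 0 ∷ 2 ∷ []) ⇔ (∃[ x ] ∃[ y ] ∃[ z ] Triple x y z e × y < x × x < z)
contains-102 e = mk⇔
  (λ (i , j , k , i<j , j<k , iso) → _ , _ , _ , reverse⁺ (lookup₃-⊆ e i<j j<k) ,
    Equivalence.from (proj₁ (iso (suc zero) zero)) (s≤s z≤n) ,
    Equivalence.from (proj₁ (iso zero (suc (suc zero)))) (s≤s (s≤s z≤n)))
  (λ (x , y , z , τ , y<x , x<z) → from y<x x<z (⊆-lookup e (reverse⁻ τ)))
  where
  from : y < x → x < z → ∃[ js ] AllPairs Fin._<_ js × map (lookup e) js ≡ x ∷ y ∷ z ∷ [] →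
         Contains e (1 ∷ 0 ∷ 2 ∷ [])
  from y<x x<z (i ∷ j ∷ k ∷ [] , (i<j ∷ _) ∷ (j<k ∷ _) ∷ _ , refl) = i , j , k , i<j , j<k , λ where
    zero             zero             → both-≡
    zero             (suc zero)       → both-> y<x (s≤s z≤n)
    zero             (suc (suc zero)) → both-< x<z (s≤s (s≤s z≤n))
    (suc zero)       zero             → both-< y<x (s≤s z≤n)
    (suc zero)       (suc zero)       → both-≡
    (suc zero)       (suc (suc zero)) → both-< (<-trans y<x x<z) (s≤s z≤n)
    (suc (suc zero)) zero             → both-> x<z (s≤s (s≤s z≤n))
    (suc (suc zero)) (suc zero)       → both-> (<-trans y<x x<z) (s≤s z≤n)
    (suc (suc zero)) (suc (suc zero)) → both-≡

contains-210 : (e : Vec ℕ n) → Contains e (2 ∷ 1 ∷ 0 ∷ []) ⇔ (∃[ x ] ∃[ y ] ∃[ z ] Triple x y z e × y < x × z < y)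
contains-210 e = mk⇔
  (λ (i , j , k , i<j , j<k , iso) → _ , _ , _ , reverse⁺ (lookup₃-⊆ e i<j j<k) ,
    Equivalence.from (proj₁ (iso (suc zero) zero)) (s≤s (s≤s z≤n)) ,
    Equivalence.from (proj₁ (iso (suc (suc zero)) (suc zero))) (s≤s z≤n))
  (λ (x , y , z , τ , y<x , z<y) → from y<x z<y (⊆-lookup e (reverse⁻ τ)))
  where
  from : y < x → z < y → ∃[ js ] AllPairs Fin._<_ js × map (lookup e) js ≡ x ∷ y ∷ z ∷ [] →
         Contains e (2 ∷ 1 ∷ 0 ∷ [])
  from y<x z<y (i ∷ j ∷ k ∷ [] , (i<j ∷ _) ∷ (j<k ∷ _) ∷ _ , refl) = i , j , k , i<j , j<k , λ where
    zero             zero             → both-≡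
    zero             (suc zero)       → both-> y<x (s≤s (s≤s z≤n))
    zero             (suc (suc zero)) → both-> (<-trans z<y y<x) (s≤s z≤n)
    (suc zero)       zero             → both-< y<x (s≤s (s≤s z≤n))
    (suc zero)       (suc zero)       → both-≡
    (suc zero)       (suc (suc zero)) → both-> z<y (s≤s z≤n)
    (suc (suc zero)) zero             → both-< (<-trans z<y y<x) (s≤s z≤n)
    (suc (suc zero)) (suc zero)       → both-< z<y (s≤s z≤n)
    (suc (suc zero)) (suc (suc zero)) → both-≡

flat : State ℕ → List ℕ
flat (b , l , s) = s ++ b ∷ l

Asc⇒desc : Asc b l → AllPairs _≥_ (b ∷ l)
Asc⇒desc asc = Asc⇒All asc ∷ tail asc
  where
  tail : ∀ {b l} → Asc b l → AllPairs _≥_ l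
  tail []              = []
  tail (_ ∷⟨ _ ⟩ asc′) = Asc⇒desc asc′

-- The cases count the entries inside the suffix. With at most one, `x` and `y` lie in the sorted
-- prefix, against `y < x`. With two, `pairs` applies. With three, `y < x` forces `x = b`, so `x`
-- acts as the maximum.
shape-avoids : Shape b l s → (z ∷ y ∷ x ∷ []) ⊆ s ++ b ∷ l → y < x → ¬ x < z × ¬ z < y
shape-avoids {b} {l} {s} shape τ y<x with split-⊆ s τ
... | []         , _ , refl , _  , τ₂ = ⊥-elim (<⇒≱ y<x (AllPairs-lookup (Asc⇒desc (Shape.ascending shape)) (∷ˡ⁻ τ₂)))
... | _ ∷ []     , _ , refl , _  , τ₂ = ⊥-elim (<⇒≱ y<x (AllPairs-lookup (Asc⇒desc (Shape.ascending shape)) τ₂))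
... | _ ∷ _ ∷ [] , _ , refl , τ₁ , τ₂ with AllPairs-lookup (Shape.pairs shape) τ₁ | to∈ τ₂
...   | y≤z , none | here refl  =
  (λ b<z → <⇒≱ b<z (All.lookup (Shape.bounded shape) (to∈ (⊆-trans (refl ∷ minimum _) τ₁)))) ,
  [ (λ y≤z z<y → <⇒≱ z<y y≤z) , (λ y≡b → ⊥-elim (<⇒≢ y<x y≡b)) ]′ y≤z
...   | y≤z , none | there x∈l =
  (λ x<z → All.lookup none x∈l (y<x , x<z)) ,
  [ (λ y≤z z<y → <⇒≱ z<y y≤z)
  , (λ { refl → ⊥-elim (<⇒≱ y<x (All.lookup (Asc⇒All (Shape.ascending shape)) x∈l)) }) ]′ y≤z
shape-avoids shape τ y<x | _ ∷ _ ∷ _ ∷ [] , _ , refl , τ₁ , _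
  with AllPairs-lookup (Shape.pairs shape) (∷ˡ⁻ τ₁) | AllPairs-lookup (Shape.pairs shape) (⊆-trans (refl ∷ refl ∷ minimum _) τ₁)
... | inj₁ x≤y , _  | _ = ⊥-elim (<⇒≱ y<x x≤y)
... | inj₂ refl , _ | y≤z , _ =
  (λ b<z → <⇒≱ b<z (All.lookup (Shape.bounded shape) (to∈ (⊆-trans (refl ∷ minimum _) τ₁)))) ,
  [ (λ y≤z z<y → <⇒≱ z<y y≤z) , (λ y≡b → ⊥-elim (<⇒≢ y<x y≡b)) ]′ y≤z
shape-avoids shape τ y<x | _ ∷ _ ∷ _ ∷ _ ∷ _ , _ , () , _

-- The inversion bound and the cut at the first descent

data Inv : List ℕ → Set where
  []  : Inv []
  _∷_ : x ≤ length l → Inv l → Inv (x ∷ l)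

-- `r` holds the entries already read, which shift the positions in `e` by `length r`.
inversion⇒Inv : (e : Vec ℕ n) → Inv r → (∀ j → lookup e j ≤ toℕ j + length r) → Inv (toList e ʳ++ r)
inversion⇒Inv []      inv e≤ = inv
inversion⇒Inv (x ∷ e) inv e≤ = inversion⇒Inv e (e≤ zero ∷ inv)
  (λ j → subst (lookup e j ≤_) (sym (+-suc (toℕ j) _)) (e≤ (suc j)))

Inv⇒inversion : (e : Vec ℕ n) → Inv (toList e ʳ++ r) → Inv r × (∀ j → lookup e j ≤ toℕ j + length r)
Inv⇒inversion []      inv = inv , λ ()
Inv⇒inversion (x ∷ e) inv with Inv⇒inversion e inv
... | x≤r ∷ inv′ , e≤ = inv′ , λ where
  zero    → x≤r
  (suc j) → subst (lookup e j ≤_) (+-suc (toℕ j) _) (e≤ j)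

Asc⇒Inv : Asc b l → Inv l
Asc⇒Inv []               = []
Asc⇒Inv (_ ∷⟨ x≤l ⟩ asc) = x≤l ∷ Asc⇒Inv asc

-- This is why the suffix carries no inversion bound of its own: its entries are at most `b`, hence
-- at most the length of the prefix.
bounded⇒Inv : All (_≤ length r) s → Inv r → Inv (s ++ r)
bounded⇒Inv []           inv = inv
bounded⇒Inv {r} {x ∷ s} (x≤r ∷ s≤r) inv =
  ≤-trans x≤r (subst (length r ≤_) (sym (length-++ s)) (m≤n+m _ (length s))) ∷ bounded⇒Inv s≤r inv

-- The head of `r` is the latest entry. While the suffix is empty it extends the prefix if it is at
-- least `b`; the first smaller entry opens the suffix.
split : ∀ r → 1 ≤ length r → Inv r → ∃[ b ] ∃[ l ] ∃[ s ] r ≡ s ++ b ∷ l × Asc b l × b ≤ length l ×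
        (s ≡ [] ⊎ ∃[ a ] Ends a s × a < b)
split (x ∷ [])    _ (x≤ ∷ _)   = x , [] , [] , refl , [] , x≤ , inj₁ refl
split (x ∷ y ∷ r) _ (x≤ ∷ inv) with split (y ∷ r) (s≤s z≤n) inv
... | b , l , s , e , asc , b≤l , inj₂ (a , ends , a<b) =
  b , l , x ∷ s , cong (x ∷_) e , asc , b≤l , inj₂ (a , x ∷ ends , a<b)
... | b , l , _ , refl , asc , b≤l , inj₁ refl with b ≤? x
...   | yes b≤x = x , b ∷ l , [] , refl , (b≤x ∷⟨ b≤l ⟩ asc) , x≤ , inj₁ refl
...   | no b≰x  = b , l , x ∷ [] , refl , asc , b≤l , inj₂ (x , [-] , ≰⇒> b≰x)

-- First descent, maximum and rank

fdesₗ : List ℕ → ℕ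
fdesₗ []          = 0
fdesₗ (x ∷ [])    = 1
fdesₗ (x ∷ y ∷ l) = if x ≤ᵇ y then suc (fdesₗ (y ∷ l)) else 1

fdes-toList : (e : Vec ℕ n) → fdes e ≡ fdesₗ (toList e)
fdes-toList []          = refl
fdes-toList (x ∷ [])    = refl
fdes-toList (x ∷ y ∷ e) = cong (λ m → if x ≤ᵇ y then suc m else 1) (fdes-toList (y ∷ e))

fdes-ascending : ∀ {w} → x ≤ y → fdesₗ (x ∷ y ∷ w) ≡ suc (fdesₗ (y ∷ w))
fdes-ascending {x} {y} x≤y with x ≤ᵇ y | ≤⇒≤ᵇ x≤y
... | true | _ = refl

fdes-descent : ∀ {w} → y < x → fdesₗ (x ∷ y ∷ w) ≡ 1
fdes-descent {y} {x} y<x with x ≤ᵇ y | ≤ᵇ⇒≤ x y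
... | false | _   = refl
... | true  | x≤y = ⊥-elim (<⇒≱ y<x (x≤y _))

fdes-prefix : ∀ {w} → Asc b l → fdesₗ (l ʳ++ (b ∷ w)) ≡ length l + fdesₗ (b ∷ w)
fdes-prefix []                               = refl
fdes-prefix {b} {x ∷ l} {w} (x≤b ∷⟨ _ ⟩ asc) = begin
  fdesₗ (l ʳ++ (x ∷ b ∷ w))        ≡⟨ fdes-prefix asc ⟩
  length l + fdesₗ (x ∷ b ∷ w)     ≡⟨ cong (_+_ (length l)) (fdes-ascending {w = w} x≤b) ⟩
  length l + suc (fdesₗ (b ∷ w))   ≡⟨ +-suc (length l) _ ⟩
  suc (length l) + fdesₗ (b ∷ w)   ∎
  where open ≡-Reasoning

Ends-reverse : Ends a s → ∃[ w ] reverse s ≡ a ∷ w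
Ends-reverse                [-]     = [] , refl
Ends-reverse {s = _ ∷ s} (x ∷ e) = let w , eq = Ends-reverse e in
  w ++ x ∷ [] , trans (unfold-reverse x s) (cong (_++ x ∷ []) eq)

-- The prefix including `b` has `length l + 1` entries. A nonempty suffix begins below `b`, and the
-- convention `e_{n+1} = -1` covers an empty one.
fdes-flat : Asc b l → s ≡ [] ⊎ (∃[ a ] Ends a s × a < b) → fdesₗ (reverse (s ++ b ∷ l)) ≡ suc (length l)
fdes-flat {b} {l} {s} asc descent = begin
  fdesₗ (reverse (s ++ b ∷ l))     ≡⟨ cong fdesₗ (++-ʳ++ s) ⟩
  fdesₗ (l ʳ++ (b ∷ reverse s))    ≡⟨ fdes-prefix asc ⟩
  length l + fdesₗ (b ∷ reverse s) ≡⟨ cong (_+_ (length l)) (last descent) ⟩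
  length l + 1                     ≡⟨ +-comm (length l) 1 ⟩
  suc (length l)                   ∎
  where
  open ≡-Reasoning
  last : ∀ {b s} → s ≡ [] ⊎ (∃[ a ] Ends a s × a < b) → fdesₗ (b ∷ reverse s) ≡ 1
  last (inj₁ refl) = refl
  last (inj₂ (a , ends , a<b)) with Ends-reverse ends
  ... | w , eq rewrite eq = fdes-descent {w = w} a<b

max-bounded : (e : Vec ℕ n) → (∀ {x} → x ∈ toList e → x ≤ b) → max e ≤ b
max-bounded []      e≤b = z≤n
max-bounded (x ∷ e) e≤b = ⊔-lub (e≤b (here refl)) (max-bounded e (e≤b ∘ there))

∈⇒≤max : (e : Vec ℕ n) → x ∈ toList e → x ≤ max e
∈⇒≤max (x ∷ e) (here refl) = m≤m⊔n x (max e)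
∈⇒≤max (x ∷ e) (there x∈)  = ≤-trans (∈⇒≤max e x∈) (m≤n⊔m x (max e))

rev : Vec ℕ n → List ℕ
rev = reverse ∘ toList

-- With `fdes = length l + 1` and `max = b` the units cancel, and the rank is `length l - b`, the
-- height of the walk.
rank⇔height : (e : Vec ℕ n) → rev e ≡ s ++ b ∷ l → All (_≤ b) s → Asc b l →
              s ≡ [] ⊎ (∃[ a ] Ends a s × a < b) → rank e ≡ + t ⇔ length l ≡ b + t
rank⇔height {s = s} {b} {l} {t} e eq s≤b asc descent = mk⇔
  (λ h → ℤ.+-injective (trans (shift (+ length l) (+ b)) (cong (λ i → + b ℤ.+ i) (trans (sym rank≡) h))))
  (λ h → trans rank≡ (trans (cong (λ m → + m ℤ.- + b) h) (unshift (+ b) (+ t))))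
  where
  toList≡ : toList e ≡ reverse (s ++ b ∷ l)
  toList≡ = trans (sym (reverse-involutive (toList e))) (cong reverse eq)
  fdes≡ : fdes e ≡ suc (length l)
  fdes≡ = trans (fdes-toList e) (trans (cong fdesₗ toList≡) (fdes-flat asc descent))
  r≤b : All (_≤ b) (s ++ b ∷ l)
  r≤b = All.++⁺ s≤b (≤-refl ∷ Asc⇒All asc)
  max≡ : max e ≡ b
  max≡ = ≤-antisym
    (max-bounded e (λ x∈ → All.lookup r≤b (subst (_ ∈_) eq (Any.reverse⁺ x∈))))
    (∈⇒≤max e (Any.reverse⁻ (subst (b ∈_) (sym eq) (∈-++⁺ʳ s (here refl)))))
  cancel : ∀ p b → (+ 1 ℤ.+ p) ℤ.- b ℤ.- + 1 ≡ p ℤ.- b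
  cancel = ℤ.solve-∀
  shift : ∀ p b → p ≡ b ℤ.+ (p ℤ.- b)
  shift = ℤ.solve-∀
  unshift : ∀ b t → b ℤ.+ t ℤ.- b ≡ t
  unshift = ℤ.solve-∀
  rank≡ : rank e ≡ + length l ℤ.- + b
  rank≡ = trans (cong₂ (λ f m → + f ℤ.- + m ℤ.- + 1) fdes≡ max≡) (cancel (+ length l) (+ b))

-- Sequences of given rank correspond to final walks

Valid : ℕ → Vec ℕ n → Set
Valid t e = IsInversionSequence e × Avoids e (1 ∷ 0 ∷ 2 ∷ []) × Avoids e (2 ∷ 1 ∷ 0 ∷ []) × rank e ≡ + t

length-rev : (e : Vec ℕ n) → length (rev e) ≡ n
length-rev e = trans (length-reverse (toList e)) (Vec.length-toList e)

length-flat : ∀ s → length (s ++ b ∷ l) ≡ suc (length s + length l)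
length-flat {b} {l} s = trans (length-++ s) (+-suc (length s) (length l))

valid⇒final : (e : Vec ℕ (N + suc t)) → Valid t e → ∃[ σ ] Final N t σ × rev e ≡ flat σ
valid⇒final {N} {t} e (inversion , avoids-102 , avoids-210 , rank≡t)
  with split (rev e) (subst (1 ≤_) (sym (length-rev e)) (m≤n⇒m≤o+n N (s≤s z≤n)))
    (inversion⇒Inv e [] (λ j → ≤-trans (inversion j) (m≤m+n _ 0)))
... | b , l , s , rev≡ , asc , b≤l , descent = (b , l , s) ,
  final-build l record { ascending = asc ; bounded = s≤b ; pairs = compatible ; descent = descent } (sized weight height) , rev≡
  where
  triple : ∀ {x y z} → (z ∷ y ∷ x ∷ []) ⊆ s ++ b ∷ l → y < x → ¬ x < z × ¬ z < y
  triple τ y<x =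
    (λ x<z → avoids-102 (Equivalence.from (contains-102 e) (_ , _ , _ , subst (_ ⊆_) (sym rev≡) τ , y<x , x<z))) ,
    (λ z<y → avoids-210 (Equivalence.from (contains-210 e) (_ , _ , _ , subst (_ ⊆_) (sym rev≡) τ , y<x , z<y)))
  pair-then : ∀ {x y z} → (z ∷ y ∷ []) ⊆ s → x ∈ b ∷ l → (z ∷ y ∷ x ∷ []) ⊆ s ++ b ∷ l
  pair-then τ x∈ = ++⁺ τ (from∈ x∈)
  -- The suffix starts with `a < b`; a later entry above `b` would form a 102 with `b` and `a`.
  below-max : ∀ {s} → (∀ {z y} → (z ∷ y ∷ []) ⊆ s → y < b → z ≤ b) →
              s ≡ [] ⊎ (∃[ a ] Ends a s × a < b) → All (_≤ b) s
  below-max f (inj₁ refl) = []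
  below-max f (inj₂ (a , [-] , a<b)) = <⇒≤ a<b ∷ []
  below-max f (inj₂ (a , _∷_ {s = s} x ends , a<b)) =
    f (refl ∷ from∈ (ends∈ ends)) a<b ∷ below-max (f ∘ (x ∷ʳ_)) (inj₂ (a , ends , a<b))
    where
    ends∈ : ∀ {a s} → Ends a s → a ∈ s
    ends∈ [-]     = here refl
    ends∈ (_ ∷ e) = there (ends∈ e)
  s≤b : All (_≤ b) s
  s≤b = below-max (λ τ y<b → ≮⇒≥ (proj₁ (triple (pair-then τ (here refl)) y<b))) descent
  compatible : AllPairs (Compatible b l) s
  compatible = AllPairs-tabulate s (λ {z} {y} τ →
    [ (λ y<b → inj₁ (≮⇒≥ (proj₂ (triple (pair-then τ (here refl)) y<b)))) , inj₂ ]′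
      (m≤n⇒m<n∨m≡n (All.lookup s≤b (to∈ (∷ˡ⁻ τ)))) ,
    All.tabulate (λ x∈l (y<x , x<z) → proj₁ (triple (pair-then τ (there x∈l)) y<x) x<z))
  height : length l ≡ b + t
  height = Equivalence.to (rank⇔height e rev≡ s≤b asc descent) rank≡t
  -- The length of the sequence is `|s| + 1 + |l|` with `|l| = b + t`, which leaves `N = b + |s|`.
  weight : b + length s ≡ N
  weight = +-cancelʳ-≡ (suc t) _ _ (begin
    b + length s + suc t         ≡⟨ regroup b (length s) t ⟩
    suc (length s + (b + t))     ≡⟨ cong (λ m → suc (length s + m)) height ⟨
    suc (length s + length l)    ≡⟨ length-flat s ⟨
    length (s ++ b ∷ l)          ≡⟨ cong length rev≡ ⟨
    length (rev e)               ≡⟨ length-rev e ⟩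
    N + suc t                    ∎)
    where
    open ≡-Reasoning
    regroup : ∀ b s t → b + s + suc t ≡ suc (s + (b + t))
    regroup = solve-∀

final⇒valid : (e : Vec ℕ (N + suc t)) → ∃[ σ ] Final N t σ × rev e ≡ flat σ → Valid t e
final⇒valid e ((b , l , s) , final , eq) with final-shape final
... | shape , size =
  (λ j → subst (lookup e j ≤_) (+-identityʳ (toℕ j)) (proj₂ (Inv⇒inversion e inv) j)) ,
  (λ contains → let x , y , z , τ , y<x , x<z = Equivalence.to (contains-102 e) contains in
    proj₁ (shape-avoids shape (subst (_ ⊆_) eq τ) y<x) x<z) ,
  (λ contains → let x , y , z , τ , y<x , z<y = Equivalence.to (contains-210 e) contains in
    proj₂ (shape-avoids shape (subst (_ ⊆_) eq τ) y<x) z<y) ,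
  Equivalence.from (rank⇔height e eq bounded ascending descent) (Sized.height size)
  where
  open Shape shape
  b≤l : b ≤ length l
  b≤l = ≤-height size
  inv : Inv (rev e)
  inv = subst Inv (sym eq) (bounded⇒Inv (All.map (λ x≤b → ≤-trans x≤b (m≤n⇒m≤1+n b≤l)) bounded) (b≤l ∷ Asc⇒Inv ascending))

-- Transfer of the count to vectors

rev-injective : {e f : Vec ℕ n} → rev e ≡ rev f → e ≡ f
rev-injective {e = e} {f} eq = trans (sym (Vec.cast-is-id refl e)) (Vec.toList-injective refl e f (reverse-injective eq))

rev-surjective : ∀ r → length r ≡ n → ∃[ e ] rev {n} e ≡ r
rev-surjective r refl = Vec.cast (length-reverse r) (fromList (reverse r)) , (begin
  reverse (toList (Vec.cast (length-reverse r) (fromList (reverse r))))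
    ≡⟨ cong reverse (Vec.toList-cast (length-reverse r) (fromList (reverse r))) ⟩
  reverse (toList (fromList (reverse r)))
    ≡⟨ cong reverse (Vec.toList∘fromList (reverse r)) ⟩
  reverse (reverse r)
    ≡⟨ reverse-involutive r ⟩
  r ∎)
  where open ≡-Reasoning

++-cancel-length : ∀ s s′ → length l ≡ length r → s ++ l ≡ s′ ++ r → s ≡ s′ × l ≡ r
++-cancel-length []      []        _ eq = refl , eq
++-cancel-length (x ∷ s) (y ∷ s′)  h eq = let s≡ , l≡ = ++-cancel-length s s′ h (∷-injectiveʳ eq) in
  cong₂ _∷_ (∷-injectiveˡ eq) s≡ , l≡
++-cancel-length []      (y ∷ s′)  h refl = ⊥-elim (m≢1+n+m _ (trans (sym h) (cong suc (length-++ s′))))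
++-cancel-length (x ∷ s) []        h refl = ⊥-elim (m≢1+n+m _ (trans h (cong suc (length-++ s))))

-- The first descent of the flattened sequence gives the length of the prefix, hence the place of
-- the cut.
flat-injective : ∀ {σ τ} → Final N t σ → Final N t τ → flat σ ≡ flat τ → σ ≡ τ
flat-injective {σ = b , l , s} {b′ , l′ , s′} f f′ eq with final-shape f | final-shape f′
... | shape , _ | shape′ , _ with ++-cancel-length s s′ length≡ eq
  where
  open ≡-Reasoning
  length≡ : suc (length l) ≡ suc (length l′)
  length≡ = begin
    suc (length l)                   ≡⟨ fdes-flat (Shape.ascending shape) (Shape.descent shape) ⟨
    fdesₗ (reverse (s ++ b ∷ l))     ≡⟨ cong (fdesₗ ∘ reverse) eq ⟩
    fdesₗ (reverse (s′ ++ b′ ∷ l′))  ≡⟨ fdes-flat (Shape.ascending shape′) (Shape.descent shape′) ⟩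
    suc (length l′)                  ∎
... | refl , refl = refl

length-final : ∀ {σ} → Final N t σ → length (flat σ) ≡ N + suc t
length-final {t = t} {b , l , s} f with final-shape f
... | _ , sized refl height = begin
  length (s ++ b ∷ l)         ≡⟨ length-flat s ⟩
  suc (length s + length l)   ≡⟨ cong (λ m → suc (length s + m)) height ⟩
  suc (length s + (b + t))    ≡⟨ regroup b (length s) t ⟨
  b + length s + suc t        ∎
  where
  open ≡-Reasoning
  regroup : ∀ b s t → b + s + suc t ≡ suc (s + (b + t))
  regroup = solve-∀

count-valid : ∀ N t → Counted (Valid {N + suc t} t) (#final N t)
count-valid N t = counted-≐ (λ {e} → final⇒valid e) (λ {e} → valid⇒final e)
  (counted-preimage rev rev-injective (λ { (_ , f , refl) → rev-surjective _ (length-final f) })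
    (counted-image flat flat-injective (count-final N t)))

proposition5p15 : ∀ (n t : ℕ) → 2 ≤ n → t ≤ n ∸ 1 →
    ∃[ xs ]
    Enumerates
    (λ (e : Vec ℕ n) →
    IsInversionSequence e ×
    Avoids e (1 ∷ 0 ∷ 2 ∷ []) ×
    Avoids e (2 ∷ 1 ∷ 0 ∷ []) ×
    rank e ≡ + t)
    xs
    × + length xs ≡
    + c (n ∸ t ∸ 1) (suc t)
    ℤ.+ + suc t ℤ.* (∑[ i < n ∸ t ∸ 2 ] (+ ((2 * i + t + 3) C i)))
    ℤ.+ (∑[ i < n ∸ t ∸ 3 ] (+ c i (6 + t) ℤ.- + c i 5))
proposition5p15 n t 2≤n t≤n∸1 =
  let xs , enumerates , length≡ = subst (λ m → Counted (Valid {m} t) (#final w t)) n≡ (count-valid w t)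
  in xs , enumerates , trans (cong +_ length≡) (trans (closed-form w t) (cong₂
       (λ u v → + c w (suc t) ℤ.+ + suc t ℤ.* (∑[ i < u ] (+ ((2 * i + t + 3) C i)))
         ℤ.+ (∑[ i < v ] (+ c i (6 + t) ℤ.- + c i 5)))
       -- The weight is `n ∸ t ∸ 1`, so the limits `w ∸ 1` and `w ∸ 2` become `n ∸ t ∸ 2` and
       -- `n ∸ t ∸ 3`.
       (∸-+-assoc (n ∸ t) 1 1) (∸-+-assoc (n ∸ t) 1 2)))
  where
  w : ℕ
  w = n ∸ t ∸ 1
  n≡ : w + suc t ≡ n
  n≡ = trans (cong (_+ suc t) (trans (∸-+-assoc n t 1) (cong (n ∸_) (+-comm t 1))))
    (m∸n+n≡m (subst (suc t ≤_) (m+[n∸m]≡n (<⇒≤ 2≤n)) (s≤s t≤n∸1)))
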